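{- The class of linearly bounded graphs is closed under synchronized products, up to isomorphism: if $G$ and $G'$ are linearly bounded graphs with labels in $\Sigma$ and $\Sigma'$ respectively, and $C\subseteq\Sigma\times\Sigma'$, then the synchronized product $G\otimes G'$ of $G$ and $G'$ with respect to $C$ is a linearly bounded graph.
   Context: Graphs. A $\Sigma$-labeled graph is a set $G\subseteq V\times\Sigma\times V$ with $\Sigma$ finite and $V$ countable; its set of vertices (support) is the set of all sources and targets of its edges. Two graphs $G,H$ are isomorphic if there is a bijection $\rho:V_H\to V_G$ with $(x,a,y)\in H$ iff $(\rho(x),a,\rho(y))\in G$. The empty word is denoted $\varepsilon$. Synchronized product. For $G,G'$ with labels in $\Sigma,\Sigma'$ and a set of constraints $C\subseteq\Sigma\times\Sigma'$, $G\otimes G'$ is the graph with labels in $C$ whose edges are the triples $((u,v),(a,b),(u',v'))$ with $(u,a,u')\in G$, $(v,b,v')\in G'$ and $(a,b)\in C$. Labeled linearly bounded Turing machines (LLBMs). An LLBM is a tuple $M=(\Gamma,\Sigma,[,],Q,q_0,F,\delta)$ where $\Gamma$ is a finite set of tape symbols, $\Sigma\subseteq\Gamma$ is the input alphabet, $[,]\notin\Gamma$ are the left and right end-markers, $Q$ is a finite set of control states disjoint from $\Gamma$, $q_0\in Q$ is the initial state, $F\subseteq Q$ is the set of final states, and $\delta$ is a finite set of labeled rules of the forms $pA\xrightarrow{\varepsilon}qB\pm$, $p[\,\xrightarrow{\varepsilon}q[+$, $p]\xrightarrow{\varepsilon}q]-$, $pB\xrightarrow{a}qAB$, $p]\xrightarrow{a}qA]$,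 $pA\xrightarrow{\varepsilon}q$, with $p,q\in Q$, $A,B\in\Gamma$, $\pm\in\{+,-\}$, $a\in\Sigma$. A configuration is a word $uqv$ with $q\in Q$, $v\neq\varepsilon$ and $uv\in[\Gamma^*]$ (left marker, then a word over $\Gamma$, then right marker). For $x\in\Sigma\cup\{\varepsilon\}$ the relation $\xrightarrow{x}$ on configurations consists of the following pairs, where $X,Y\in\Gamma\cup\{[,]\}$: $upXv\xrightarrow{x}uYqv$ if $pX\xrightarrow{x}qY+\in\delta$; $uCpXv\xrightarrow{x}uqCYv$ (with $C\in\Gamma\cup\{[\}$ a tape cell content) if $pX\xrightarrow{x}qY-\in\delta$; $upAv\xrightarrow{\varepsilon}uqv$ if $pA\xrightarrow{\varepsilon}q\in\delta$; $upXv\xrightarrow{a}uqAXv$ if $pX\xrightarrow{a}qAX\in\delta$. Normalized LLBMs. $M$ is normalized if $Q$ is the disjoint union of $Q_\Sigma$ (external states) and $Q_\varepsilon$ (internal states) such that $F\subseteq Q_\Sigma$, every rule labeled by a letter of $\Sigma$ has its left-hand state $p$ in $Q_\Sigma$, every rule labeled by $\varepsilon$ has its left-hand state $p$ in $Q_\varepsilon$, and for every $p\in Q_\varepsilon$ and $X\in\Gamma\cup\{[,]\}$ there is a rule of the form $pX\xrightarrow{\varepsilon}qY\pm$ in $\delta$. A configuration is external if its control state is in $Q_\Sigma$. Linearly bounded graphs. The transition graph of a normalized LLBM $M$ is $G_M=\{(c,a,c')\mid a\in\Sigma,\ c,c' \text{ external configurations, } c\xrightarrow{a\varepsilon^*}c'\}$,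 where $c\xrightarrow{a\varepsilon^*}c'$ means one $a$-transition followed by finitely many (possibly zero) $\varepsilon$-transitions. A linearly bounded graph is any graph isomorphic to the transition graph of some normalized LLBM. -}

module Defs where

open import Data.Bool using (Bool; T; not)
open import Data.Fin using (Fin)
open import Data.List using (List; []; _∷_; _++_; _ʳ++_; map)
open import Data.List.Membership.Propositional using (_∈_)
open import Data.List.Relation.Unary.All using (All)
open import Data.Maybe using (Maybe; just; nothing)
open import Data.Nat using (ℕ)
open import Data.Product using (∃; ∃-syntax; _×_; _,_; proj₁; proj₂)
open import Data.Sum using (_⊎_)
open import Function.Bundles using (Bijection; _↔_; _↣_; _⇔_)
open import Level using (0ℓ)
open import Relation.Binary.Bundles using (Setoid)
open import Relation.Binary.Construct.Closure.ReflexiveTransitive using (Star)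
import Relation.Binary.Construct.On as On
open import Relation.Binary.PropositionalEquality using (_≡_; _≢_; setoid)

Finite : Set → Set
Finite A = ∃[ n ] (A ↔ Fin n)

Countable : Set → Set
Countable A = A ↣ ℕ

-- Subsets are only taken of finite sets, where classically every subset has
-- a Boolean characteristic function.
Subset : Set → Set
Subset A = A → Bool

⟦_⟧ : {A : Set} → Subset A → Set
⟦ S ⟧ = ∃[ x ] T (S x)

Graph : Set → Set → Set₁
Graph V Σ = V → Σ → V → Set

InSupport : {V Σ : Set} → Graph V Σ → V → Set
InSupport G x = ∃[ a ] ∃[ y ] (G x a y ⊎ G y a x)

-- Two elements of the support are equal when the underlying elements of V
-- are: the edge witnessing membership is immaterial.
support : {V Σ : Set} → Graph V Σ → Setoid 0ℓ 0ℓ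
support {V} G = On.setoid {B = ∃ (InSupport G)} (setoid V) proj₁

infix 4 _≅_

record _≅_ {V W Σ : Set} (G : Graph V Σ) (H : Graph W Σ) : Set where
  field
    ρ : Bijection (support H) (support G)

  open Bijection ρ using (to)

  field
    edges : ∀ x a y → H (proj₁ x) a (proj₁ y) ⇔ G (proj₁ (to x)) a (proj₁ (to y))

infix 6 _⊗[_]_

_⊗[_]_ : {V V′ Σ Σ′ : Set} →
         Graph V Σ → (C : Subset (Σ × Σ′)) → Graph V′ Σ′ → Graph (V × V′) ⟦ C ⟧
(G ⊗[ C ] G′) (u , v) ((a , b) , _) (u′ , v′) = G u a u′ × G′ v b v′

data Cell (Γ : Set) : Set where
  ⊢   : Cell Γ      -- the end-marker [
  ⊣   : Cell Γ      -- the end-marker ]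
  sym : Γ → Cell Γ

data Direction : Set where
  + - : Direction

-- Right-hand sides qY±, qAX and q.
data RHS (Γ Q : Set) : Set where
  write  : Q → Cell Γ → Direction → RHS Γ Q
  insert : Q → Γ → Cell Γ → RHS Γ Q
  delete : Q → RHS Γ Q

-- Labels are letters (just a) or ε (nothing).
Rule : (Σ Γ Q : Set) → Set
Rule Σ Γ Q = Q × Cell Γ × Maybe Σ × RHS Γ Q

data WellFormed {Σ Γ Q : Set} : Rule Σ Γ Q → Set where
  rewriteSym : ∀ {p A q B d} → WellFormed (p , sym A , nothing , write q (sym B) d)
  bounceLeft : ∀ {p q}       → WellFormed (p , ⊢ , nothing , write q ⊢ +)
  bounceRight : ∀ {p q}      → WellFormed (p , ⊣ , nothing , write q ⊣ -)
  insertSym  : ∀ {p B a q A} → WellFormed (p , sym B , just a , insert q A (sym B))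
  insertEnd  : ∀ {p a q A}   → WellFormed (p , ⊣ , just a , insert q A ⊣)
  deleteSym  : ∀ {p A q}     → WellFormed (p , sym A , nothing , delete q)

record LLBM (Σ : Set) : Set₁ where
  field
    Γ        : Set
    Γ-finite : Finite Γ
    Σ-finite : Finite Σ
    Σ⊆Γ      : Σ ↣ Γ
    Q        : Set
    Q-finite : Finite Q
    q₀       : Q
    F        : Subset Q
    δ        : List (Rule Σ Γ Q)
    δ-forms  : All WellFormed δ

-- The word u q v, with u stored in reverse: the head of `left` is the cell
-- immediately to the left of the control state.
record Word (Γ Q : Set) : Set where
  constructor ⟨_,_,_⟩
  field
    left  : List (Cell Γ)
    state : Q
    right : List (Cell Γ)

module _ {Σ : Set} (M : LLBM Σ) where
  open LLBM M

  IsConfiguration : Word Γ Q → Set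
  IsConfiguration ⟨ u , _ , v ⟩ =
    v ≢ [] × ∃[ w ] (u ʳ++ v ≡ ⊢ ∷ map sym w ++ ⊣ ∷ [])

  -- Because of `δ-forms`, a step from a configuration leads to a
  -- configuration, so validity need not be repeated at every step.
  data Step : Word Γ Q → Maybe Σ → Word Γ Q → Set where
    moveRight : ∀ {u p X v x q Y} → (p , X , x , write q Y +) ∈ δ →
                Step ⟨ u , p , X ∷ v ⟩ x ⟨ Y ∷ u , q , v ⟩
    moveLeft  : ∀ {u C p X v x q Y} → (p , X , x , write q Y -) ∈ δ →
                Step ⟨ C ∷ u , p , X ∷ v ⟩ x ⟨ u , q , C ∷ Y ∷ v ⟩
    erase     : ∀ {u p A v q} → (p , sym A , nothing , delete q) ∈ δ →
                Step ⟨ u , p , sym A ∷ v ⟩ nothing ⟨ u , q , v ⟩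
    extend    : ∀ {u p X v a q A} → (p , X , just a , insert q A X) ∈ δ →
                Step ⟨ u , p , X ∷ v ⟩ (just a) ⟨ u , q , sym A ∷ X ∷ v ⟩

  -- Q_Σ consists of the states where Q-Σ is true, Q_ε of the others.
  record Normalized : Set where
    field
      Q-Σ         : Subset Q
      F⊆Q-Σ       : ∀ {q} → T (F q) → T (Q-Σ q)
      letterRules : ∀ {p X a r} → (p , X , just a , r) ∈ δ → T (Q-Σ p)
      εRules      : ∀ {p X r} → (p , X , nothing , r) ∈ δ → T (not (Q-Σ p))
      complete    : ∀ {p} → T (not (Q-Σ p)) → ∀ X →
                    ∃[ q ] ∃[ Y ] ∃[ d ] ((p , X , nothing , write q Y d) ∈ δ)

  transitionGraph : Normalized → Graph (Word Γ Q) Σ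
  transitionGraph N c a c′ =
    ExternalConfiguration c × ExternalConfiguration c′ ×
    ∃[ c₁ ] (Step c (just a) c₁ × Star (λ d d′ → Step d nothing d′) c₁ c′)
    where
    open Normalized N
    ExternalConfiguration : Word Γ Q → Set
    ExternalConfiguration d = IsConfiguration d × T (Q-Σ (Word.state d))

LinearlyBounded : {V Σ : Set} → Graph V Σ → Set₁
LinearlyBounded {Σ = Σ} G =
  ∃[ M ] ∃[ N ] (G ≅ transitionGraph {Σ} M N)

{-# OPTIONS --safe #-}

-- The product machine keeps a configuration u q v of each factor as a literal
-- word over control states and cells, one word per layer of its tape, and pads
-- the shorter one with blanks; its external configurations have the head on ⊣
-- and no doubly blank last cell, so that each pair of configurations has exactly
-- one code. A letter (a , b) appends a doubly blank cell. The machine then sweeps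
-- its tape from left to right, again and again, each sweep being a
-- letter-to-letter transduction of both layers: the first checks that both hold
-- external configurations (no other tape may have an edge),
-- the second performs the steps a and b, the following ones at most one ε-step
-- per layer each, and the last checks that both configurations are external
-- again. Finally trailing doubly blank cells are erased. An ε-step shifts a layer
-- by at most one cell, which a transducer with a one-cell buffer can do.
module Submission where

open import Defs
open import Data.Bool using (true; false; T; not)
open import Data.Bool.Properties using (T-irrelevant)
open import Data.Empty using (⊥; ⊥-elim)
open import Data.Fin using (Fin; zero; suc)
open import Data.Fin.Properties using (0↔⊥; 1↔⊤; +↔⊎; *↔×)
open import Data.List using (List; []; _∷_; _++_; _ʳ++_; map; reverse; replicate; allFin;
  cartesianProduct)
open import Data.List.Membership.Propositional using (_∈_)
open import Data.List.Membership.Propositional.Properties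
  using (∈-map⁺; ∈-map⁻; ∈-++⁺ˡ; ∈-++⁺ʳ; ∈-cartesianProduct⁺; ∈-allFin)
open import Data.List.Properties
  using (∷-injective; ʳ++-defn; map-++; reverse-++; reverse-injective; reverse-involutive;
    unfold-reverse)
open import Data.List.Relation.Unary.All using (lookup; tabulate)
open import Data.List.Relation.Unary.Any using (here; there)
open import Data.Maybe using (Maybe; just; nothing; maybe)
open import Data.Nat using (ℕ; zero; suc)
open import Data.Product using (∃; ∃-syntax; _×_; _,_; proj₁; proj₂)
open import Data.Product.Function.NonDependent.Propositional using (_×-↔_)
open import Data.Sum using (_⊎_; inj₁; inj₂; [_,_])
open import Data.Sum.Function.Propositional using (_⊎-↔_)
open import Data.Unit using (⊤; tt)
open import Function using (_∘_)
open import Function.Bundles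
  using (Bijection; Equivalence; Injection; Inverse; _↔_; _↣_; mk↔ₛ′; mk↣; mk⇔)
open import Function.Properties.Inverse using (↔-refl; ↔-sym; ↔-trans)
open import Relation.Binary.Construct.Closure.ReflexiveTransitive using (Star; ε; _◅_; _◅◅_)
open import Relation.Binary.PropositionalEquality
  using (_≡_; _≢_; refl; trans; cong; cong₂; subst) renaming (sym to ≡-sym)

private variable
  A B : Set

-- Finite and enumerable types

⟦⟧-≡ : {S : Subset A} {x y : ⟦ S ⟧} → proj₁ x ≡ proj₁ y → x ≡ y
⟦⟧-≡ {x = _ , s} {y = _ , t} refl = cong (_ ,_) (T-irrelevant s t)

-- Machines carry these bijections, and with-abstraction would normalise them.
abstract
  finite-⊥ : Finite ⊥
  finite-⊥ = 0 , ↔-sym 0↔⊥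

  finite-⊤ : Finite ⊤
  finite-⊤ = 1 , ↔-sym 1↔⊤

  finite-⊎ : Finite A → Finite B → Finite (A ⊎ B)
  finite-⊎ (m , A↔m) (n , B↔n) = _ , ↔-trans (A↔m ⊎-↔ B↔n) (↔-sym +↔⊎)

  finite-× : Finite A → Finite B → Finite (A × B)
  finite-× (m , A↔m) (n , B↔n) = _ , ↔-trans (A↔m ×-↔ B↔n) (↔-sym *↔×)

  finite-↔ : A ↔ B → Finite B → Finite A
  finite-↔ A↔B (n , B↔n) = n , ↔-trans A↔B B↔n

  finite-Maybe : Finite A → Finite (Maybe A)
  finite-Maybe A-finite = finite-↔
    (mk↔ₛ′ (maybe inj₂ (inj₁ tt)) [ (λ _ → nothing) , just ]
      (λ { (inj₁ tt) → refl ; (inj₂ _) → refl }) (λ { nothing → refl ; (just _) → refl }))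
    (finite-⊎ finite-⊤ A-finite)

  finite-Cell : Finite A → Finite (Cell A)
  finite-Cell A-finite = finite-↔
    (mk↔ₛ′ (λ { ⊢ → nothing ; ⊣ → just nothing ; (sym A) → just (just A) })
      (λ { nothing → ⊢ ; (just nothing) → ⊣ ; (just (just A)) → sym A })
      (λ { nothing → refl ; (just nothing) → refl ; (just (just _)) → refl })
      (λ { ⊢ → refl ; ⊣ → refl ; (sym _) → refl }))
    (finite-Maybe (finite-Maybe A-finite))

  -- Induction on `n`: the index `zero` contributes `T (S zero)`, which is a singleton or empty.
  finite-⟦Fin⟧ : ∀ n (S : Subset (Fin n)) → Finite ⟦ S ⟧
  finite-⟦Fin⟧ zero S = finite-↔ (mk↔ₛ′ (λ ()) (λ ()) (λ ()) (λ ())) finite-⊥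
  finite-⟦Fin⟧ (suc n) S = finite-↔
    (mk↔ₛ′ (λ { (zero , t) → inj₁ t ; (suc i , t) → inj₂ (i , t) })
      [ (λ t → zero , t) , (λ { (i , t) → suc i , t }) ]
      (λ { (inj₁ _) → refl ; (inj₂ _) → refl })
      (λ { (zero , _) → refl ; (suc _ , _) → refl }))
    (finite-⊎ (finite-T (S zero)) (finite-⟦Fin⟧ n (S ∘ suc)))
    where
    finite-T : ∀ b → Finite (T b)
    finite-T true  = finite-⊤
    finite-T false = finite-⊥

  finite-⟦⟧ : Finite A → (S : Subset A) → Finite ⟦ S ⟧
  finite-⟦⟧ (n , A↔n) S = finite-↔
    (mk↔ₛ′ (λ { (x , t) → to x , subst (T ∘ S) (≡-sym (strictlyInverseʳ x)) t })
      (λ { (i , t) → from i , t })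
      (λ { (i , _) → ⟦⟧-≡ (strictlyInverseˡ i) })
      (λ { (x , _) → ⟦⟧-≡ (strictlyInverseʳ x) }))
    (finite-⟦Fin⟧ n (S ∘ from))
    where open Inverse A↔n

-- Repetitions are allowed, so a surjection from a type of codes is enough to enumerate rules and
-- transitions.
Enumerable : Set → Set
Enumerable A = ∃[ xs ] (∀ (x : A) → x ∈ xs)

enumerable-⊎ : Enumerable A → Enumerable B → Enumerable (A ⊎ B)
enumerable-⊎ (xs , ∈xs) (ys , ∈ys) =
  map inj₁ xs ++ map inj₂ ys ,
  [ ∈-++⁺ˡ ∘ ∈-map⁺ inj₁ ∘ ∈xs , ∈-++⁺ʳ _ ∘ ∈-map⁺ inj₂ ∘ ∈ys ]

enumerable-× : Enumerable A → Enumerable B → Enumerable (A × B)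
enumerable-× (xs , ∈xs) (ys , ∈ys) =
  cartesianProduct xs ys , λ { (x , y) → ∈-cartesianProduct⁺ (∈xs x) (∈ys y) }

enumerable-image : (f : A → B) → (∀ y → ∃[ x ] f x ≡ y) → Enumerable A → Enumerable B
enumerable-image f onto (xs , ∈xs) =
  map f xs , λ y → subst (_∈ map f xs) (proj₂ (onto y)) (∈-map⁺ f (∈xs (proj₁ (onto y))))

finite⇒enumerable : Finite A → Enumerable A
finite⇒enumerable (n , A↔n) =
  enumerable-image from (λ x → to x , strictlyInverseʳ x) (allFin n , ∈-allFin)
  where open Inverse A↔n

enumerable-∈ : (xs : List A) → Enumerable (∃[ x ] x ∈ xs)
enumerable-∈ []       = [] , λ ()
enumerable-∈ (x ∷ xs) = enumerable-image
  (λ { (inj₁ tt) → x , here refl ; (inj₂ (y , y∈xs)) → y , there y∈xs })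
  (λ { (_ , here refl) → inj₁ tt , refl ; (y , there y∈xs) → inj₂ (y , y∈xs) , refl })
  (enumerable-⊎ (finite⇒enumerable finite-⊤) (enumerable-∈ xs))

-- Graphs isomorphic on their supports

-- Replaces a bijection between supports by a relation that may also hold outside them. The two edge
-- conditions make it total and onto on the supports, and such relations compose without any
-- handling of membership in supports.
record Correspondence {V W Σ : Set} (G : Graph V Σ) (H : Graph W Σ) : Set₁ where
  field
    _~_         : W → V → Set
    functional  : ∀ {w v v′} → w ~ v → w ~ v′ → v ≡ v′
    injective   : ∀ {w w′ v} → w ~ v → w′ ~ v → w ≡ w′
    edge-to     : ∀ {w a w′} → H w a w′ → ∃[ v ] ∃[ v′ ] (w ~ v × w′ ~ v′ × G v a v′)
    edge-from   : ∀ {v a v′} → G v a v′ → ∃[ w ] ∃[ w′ ] (w ~ v × w′ ~ v′ × H w a w′)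

module _ {V W Σ : Set} {G : Graph V Σ} {H : Graph W Σ} where

  -- The image of a vertex is read off the edge that witnesses its membership in the support;
  -- functionality makes the choice of this edge immaterial.
  correspondence⇒≅ : Correspondence G H → G ≅ H
  correspondence⇒≅ C = record
    { ρ = record
      { to = image
      ; cong = λ {x} {y} x≡y → functional (image~ x) (subst (_~ _) (≡-sym x≡y) (image~ y))
      ; bijective =
          (λ {x} {y} eq → injective (image~ x) (subst (_ ~_) (≡-sym eq) (image~ y)))
        , λ y → preimage y , λ {x} x≡ → functional (image~ x) (subst (_~ _) (≡-sym x≡) (preimage~ y))
      }
    ; edges = λ x a y → mk⇔ (edge⁺ x a y) (edge⁻ x a y)
    }
    where
    open Correspondence C
    image : ∃ (InSupport H) → ∃ (InSupport G)
    image (_ , a , _ , inj₁ e) with v , v′ , _ , _ , g ← edge-to e = v , a , v′ , inj₁ g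
    image (_ , a , _ , inj₂ e) with v , v′ , _ , _ , g ← edge-to e = v′ , a , v , inj₂ g

    image~ : ∀ x → proj₁ x ~ proj₁ (image x)
    image~ (_ , _ , _ , inj₁ e) = let _ , _ , r , _ = edge-to e in r
    image~ (_ , _ , _ , inj₂ e) = let _ , _ , _ , r , _ = edge-to e in r

    preimage : ∃ (InSupport G) → ∃ (InSupport H)
    preimage (_ , a , _ , inj₁ g) with w , w′ , _ , _ , e ← edge-from g = w , a , w′ , inj₁ e
    preimage (_ , a , _ , inj₂ g) with w , w′ , _ , _ , e ← edge-from g = w′ , a , w , inj₂ e

    preimage~ : ∀ y → proj₁ (preimage y) ~ proj₁ y
    preimage~ (_ , _ , _ , inj₁ g) = let _ , _ , r , _ = edge-from g in r
    preimage~ (_ , _ , _ , inj₂ g) = let _ , _ , _ , r , _ = edge-from g in r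

    edge⁺ : ∀ x a y → H (proj₁ x) a (proj₁ y) → G (proj₁ (image x)) a (proj₁ (image y))
    edge⁺ x a y e with v , v′ , r , r′ , g ← edge-to e
      with refl ← functional r (image~ x) | refl ← functional r′ (image~ y) = g

    edge⁻ : ∀ x a y → G (proj₁ (image x)) a (proj₁ (image y)) → H (proj₁ x) a (proj₁ y)
    edge⁻ x a y g with w , w′ , r , r′ , e ← edge-from g
      with refl ← injective r (image~ x) | refl ← injective r′ (image~ y) = e

  -- Quantifying over the membership proof `p` makes the relation one between bare vertices.
  ≅⇒correspondence : G ≅ H → Correspondence G H
  ≅⇒correspondence G≅H = record
    { _~_ = λ w v → ∃[ p ] proj₁ (to (w , p)) ≡ v
    ; functional = λ { (p , refl) (q , refl) → Bijection.cong ρ {_ , p} {_ , q} refl }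
    ; injective = λ { (p , refl) (q , eq) → Bijection.injective ρ {_ , p} {_ , q} (≡-sym eq) }
    ; edge-to = λ {w} {a} {w′} e →
        let p = a , w′ , inj₁ e ; q = a , w , inj₂ e in
        _ , _ , (p , refl) , (q , refl) , Equivalence.to (edges (w , p) a (w′ , q)) e
    ; edge-from = λ {v} {a} {v′} g →
        let (w , p) , eq = surjective (v , a , v′ , inj₁ g)
            (w′ , q) , eq′ = surjective (v′ , a , v , inj₂ g)
            ρw≡v = eq {w , p} refl
            ρw′≡v′ = eq′ {w′ , q} refl in
        w , w′ , (p , ρw≡v) , (q , ρw′≡v′) ,
        Equivalence.from (edges (w , p) a (w′ , q))
          (subst (λ x → G x a (proj₁ (to (w′ , q)))) (≡-sym ρw≡v) (subst (G v a) (≡-sym ρw′≡v′) g))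
    }
    where
    open _≅_ G≅H
    open Bijection ρ using (to; surjective)

correspondence-trans : {U V W Σ : Set} {F : Graph U Σ} {G : Graph V Σ} {H : Graph W Σ} →
                       Correspondence F G → Correspondence G H → Correspondence F H
correspondence-trans C D = record
  { _~_ = λ w u → ∃[ v ] (w D.~ v × v C.~ u)
  ; functional = functional
  ; injective = injective
  ; edge-to = λ h →
      let _ , _ , s , s′ , g = D.edge-to h ; _ , _ , r , r′ , f = C.edge-to g in
      _ , _ , (_ , s , r) , (_ , s′ , r′) , f
  ; edge-from = λ f →
      let _ , _ , r , r′ , g = C.edge-from f ; _ , _ , s , s′ , h = D.edge-from g in
      _ , _ , (_ , s , r) , (_ , s′ , r′) , h
  }
  where
  module C = Correspondence C
  module D = Correspondence D
  functional : ∀ {w u u′} → ∃[ v ] (w D.~ v × v C.~ u) → ∃[ v ] (w D.~ v × v C.~ u′) → u ≡ u′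
  functional (_ , s , r) (_ , s′ , r′) with refl ← D.functional s s′ = C.functional r r′
  injective : ∀ {w w′ u} → ∃[ v ] (w D.~ v × v C.~ u) → ∃[ v ] (w′ D.~ v × v C.~ u) → w ≡ w′
  injective (_ , s , r) (_ , s′ , r′) with refl ← C.injective r r′ = D.injective s s′

-- The support of a product may be smaller than the product of the supports. This does no harm to
-- relations: an edge of the product is a pair of edges, and each of them is transferred separately.
correspondence-⊗ : {V V′ W W′ Σ Σ′ : Set} {G : Graph V Σ} {G′ : Graph V′ Σ′}
                   {H : Graph W Σ} {H′ : Graph W′ Σ′} (C : Subset (Σ × Σ′)) →
                   Correspondence G H → Correspondence G′ H′ →
                   Correspondence (G ⊗[ C ] G′) (H ⊗[ C ] H′)
correspondence-⊗ C D D′ = record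
  { _~_ = λ { (w , w′) (v , v′) → w D.~ v × w′ D′.~ v′ }
  ; functional = λ { (r , r′) (s , s′) → cong₂ _,_ (D.functional r s) (D′.functional r′ s′) }
  ; injective = λ { (r , r′) (s , s′) → cong₂ _,_ (D.injective r s) (D′.injective r′ s′) }
  ; edge-to = λ { (h , h′) →
      let _ , _ , r , s , g = D.edge-to h ; _ , _ , r′ , s′ , g′ = D′.edge-to h′ in
      _ , _ , (r , r′) , (s , s′) , g , g′ }
  ; edge-from = λ { (g , g′) →
      let _ , _ , r , s , h = D.edge-from g ; _ , _ , r′ , s′ , h′ = D′.edge-from g′ in
      _ , _ , (r , r′) , (s , s′) , h , h′ }
  }
  where
  module D = Correspondence D
  module D′ = Correspondence D′

-- Machines that sweep their tape

pattern #0 x = inj₁ x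
pattern #1 x = inj₂ (#0 x)
pattern #2 x = inj₂ (#1 x)
pattern #3 x = inj₂ (#2 x)
pattern #4 x = inj₂ (#3 x)
pattern #5 x = inj₂ (#4 x)
pattern #6 x = inj₂ (#5 x)
pattern #7 x = inj₂ (#6 x)
pattern #8 x = inj₂ (#7 x)
pattern #9 x = inj₂ (#8 x)

data Run {Z K : Set} (Trans : Z → K → K → Z → Set) : Z → List K → List K → Z → Set where
  []  : ∀ {z} → Run Trans z [] [] z
  _∷_ : ∀ {z x y z₁ xs ys z₂} →
        Trans z x y z₁ → Run Trans z₁ xs ys z₂ → Run Trans z (x ∷ xs) (y ∷ ys) z₂

-- A sweep rewrites the tape from left to right, one cell at a time; `Turn`
-- decides at its end between a new sweep and halting (`nothing`).
record SweepingAutomaton (Σ K : Set) : Set₁ where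
  field
    Z                : Set
    Z-finite         : Finite Z
    Trans            : Z → K → K → Z → Set
    Trans-enumerable : Enumerable (∃[ z ] ∃[ x ] ∃[ y ] ∃[ z₁ ] Trans z x y z₁)
    Turn             : Z → Maybe Z → Set
    Turn-enumerable  : Enumerable (∃[ z ] ∃[ m ] Turn z m)
    start            : Σ → Z
    blank            : K
    nonblank         : Subset K

  -- The tape is reversed here.
  data Trim : List K → List K → Set where
    stop : ∀ {x u} → T (nonblank x) → Trim (x ∷ u) (x ∷ u)
    drop : ∀ {x u u′} → T (not (nonblank x)) → Trim u u′ → Trim (x ∷ u) u′

  data Trimmed : List K → Set where
    trimmed : ∀ {x u} → T (nonblank x) → Trimmed (x ∷ u)

  trim-trimmed : ∀ {u u′} → Trim u u′ → Trimmed u′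
  trim-trimmed (stop t)   = trimmed t
  trim-trimmed (drop _ t) = trim-trimmed t

  -- `w` is in reading order, but `u` is reversed, as is the part of a configuration left of the
  -- head.
  data Computation (z : Z) (w u : List K) : Set where
    again : ∀ {w₁ z₁ z₂} → Run Trans z w w₁ z₁ → Turn z₁ (just z₂) →
            Computation z₂ w₁ u → Computation z w u
    halt  : ∀ {w₁ z₁} → Run Trans z w w₁ z₁ → Turn z₁ nothing →
            Trim (reverse w₁) u → Computation z w u

  computation-trimmed : ∀ {z w u} → Computation z w u → Trimmed u
  computation-trimmed (again _ _ c) = computation-trimmed c
  computation-trimmed (halt _ _ t)  = trim-trimmed t

module SweepingMachine
  {Σ K : Set} (Σ-finite : Finite Σ) (K-finite : Finite K) (Σ⊆K : Σ ↣ K)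
  (A : SweepingAutomaton Σ K) where

  open SweepingAutomaton A

  Internal State : Set
  Internal = Z ⊎ Z ⊎ Z ⊎ Z ⊎ ⊤ ⊎ ⊤ ⊎ ⊥
  State = ⊤ ⊎ Internal

  pattern resting     = #0 tt
  pattern inserted z  = #1 z
  pattern checking z  = #2 z
  pattern returning z = #3 z
  pattern sweeping z  = #4 z
  pattern trimming    = #5 tt
  pattern dead        = #6 tt

  internal-finite : Finite Internal
  internal-finite =
    finite-⊎ Z-finite (finite-⊎ Z-finite (finite-⊎ Z-finite (finite-⊎ Z-finite
    (finite-⊎ finite-⊤ (finite-⊎ finite-⊤ finite-⊥)))))

  external : Subset State
  external (inj₁ _) = true
  external (inj₂ _) = false

  turned : Maybe Z → State
  turned (just z) = returning z
  turned nothing  = trimming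

  -- A letter can be read only on `⊣`. After the insertion, `skip` passes the new blank cell and
  -- `check` inspects the former last cell, so that untrimmed tapes have no outgoing edges. At the
  -- end, `rest` puts the head back on `⊣`.
  data Rules : Rule Σ K State → Set where
    read     : ∀ a → Rules (resting , ⊣ , just a , insert (inserted (start a)) blank ⊣)
    skip     : ∀ z x → Rules (inserted z , sym x , nothing , write (checking z) (sym x) -)
    check    : ∀ z x → T (nonblank x) →
               Rules (checking z , sym x , nothing , write (returning z) (sym x) -)
    return   : ∀ z x → Rules (returning z , sym x , nothing , write (returning z) (sym x) -)
    begin    : ∀ z → Rules (returning z , ⊢ , nothing , write (sweeping z) ⊢ +)
    sweep    : ∀ {z x y z₁} → Trans z x y z₁ →
               Rules (sweeping z , sym x , nothing , write (sweeping z₁) (sym y) +)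
    turn     : ∀ {z m} → Turn z m → Rules (sweeping z , ⊣ , nothing , write (turned m) ⊣ -)
    trim     : ∀ x → T (not (nonblank x)) → Rules (trimming , sym x , nothing , delete trimming)
    back     : Rules (trimming , ⊣ , nothing , write trimming ⊣ -)
    rest     : ∀ x → T (nonblank x) →
               Rules (trimming , sym x , nothing , write resting (sym x) +)
    -- Normalization demands a rewriting move from every internal state on every cell. The last
    -- three rules supply it by leading into a trap.
    die      : ∀ q x → Rules (inj₂ q , sym x , nothing , write dead (sym x) +)
    dieLeft  : ∀ q → Rules (inj₂ q , ⊢ , nothing , write dead ⊢ +)
    dieRight : ∀ q → Rules (inj₂ q , ⊣ , nothing , write dead ⊣ -)

  rules-enumerable : Enumerable (∃ Rules)
  rules-enumerable = enumerable-image
    (λ { (#0 (#0 a))             → _ , read a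
       ; (#0 (#1 (z , x)))       → _ , skip z x
       ; (#0 (#2 (z , x , t)))   → _ , check z x t
       ; (#0 (#3 (z , x)))       → _ , return z x
       ; (#0 (#4 z))             → _ , begin z
       ; (#1 (#0 (_ , _ , _ , _ , t))) → _ , sweep t
       ; (#1 (#1 (_ , _ , t)))   → _ , turn t
       ; (#1 (#2 (x , t)))       → _ , trim x t
       ; (#1 (#3 tt))            → _ , back
       ; (#1 (#4 (x , t)))       → _ , rest x t
       ; (#2 (#0 (q , x)))       → _ , die q x
       ; (#2 (#1 q))             → _ , dieLeft q
       ; (#2 (#2 q))             → _ , dieRight q
       })
    (λ { (_ , read a)     → #0 (#0 a) , refl
       ; (_ , skip z x)   → #0 (#1 (z , x)) , refl
       ; (_ , check z x t) → #0 (#2 (z , x , t)) , refl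
       ; (_ , return z x) → #0 (#3 (z , x)) , refl
       ; (_ , begin z)    → #0 (#4 z) , refl
       ; (_ , sweep t)    → #1 (#0 (_ , _ , _ , _ , t)) , refl
       ; (_ , turn t)     → #1 (#1 (_ , _ , t)) , refl
       ; (_ , trim x t)   → #1 (#2 (x , t)) , refl
       ; (_ , back)       → #1 (#3 tt) , refl
       ; (_ , rest x t)   → #1 (#4 (x , t)) , refl
       ; (_ , die q x)    → #2 (#0 (q , x)) , refl
       ; (_ , dieLeft q)  → #2 (#1 q) , refl
       ; (_ , dieRight q) → #2 (#2 q) , refl
       })
    (enumerable-⊎
      (finite⇒enumerable (finite-⊎ Σ-finite (finite-⊎ Z×K
        (finite-⊎ (finite-× Z-finite (finite-⟦⟧ K-finite nonblank)) (finite-⊎ Z×K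
        (finite-⊎ Z-finite finite-⊥))))))
      (enumerable-⊎
        (enumerable-⊎ Trans-enumerable (enumerable-⊎ Turn-enumerable (finite⇒enumerable
          (finite-⊎ (finite-⟦⟧ K-finite (not ∘ nonblank)) (finite-⊎ finite-⊤
          (finite-⊎ (finite-⟦⟧ K-finite nonblank) finite-⊥))))))
        (finite⇒enumerable (finite-⊎ (finite-⊎ (finite-× internal-finite K-finite)
          (finite-⊎ internal-finite (finite-⊎ internal-finite finite-⊥))) finite-⊥))))
    where
    Z×K : Finite (Z × K)
    Z×K = finite-× Z-finite K-finite

  wellFormed : ∀ {r} → Rules r → WellFormed r
  wellFormed (read _)      = insertEnd
  wellFormed (skip _ _)    = rewriteSym
  wellFormed (check _ _ _) = rewriteSym
  wellFormed (return _ _)  = rewriteSym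
  wellFormed (begin _)     = bounceLeft
  wellFormed (sweep _)     = rewriteSym
  wellFormed (turn _)      = bounceRight
  wellFormed (trim _ _)    = deleteSym
  wellFormed back          = bounceRight
  wellFormed (rest _ _)    = rewriteSym
  wellFormed (die _ _)     = rewriteSym
  wellFormed (dieLeft _)   = bounceLeft
  wellFormed (dieRight _)  = bounceRight

  rules : List (Rule Σ K State)
  rules = map proj₁ (proj₁ rules-enumerable)

  rules⁺ : ∀ {r} → Rules r → r ∈ rules
  rules⁺ r = ∈-map⁺ proj₁ (proj₂ rules-enumerable (_ , r))

  -- Turns membership in the rule list into a derivation, so that soundness proofs can proceed by
  -- cases on the applicable rules.
  rules⁻ : ∀ {r} → r ∈ rules → Rules r
  rules⁻ r∈ with (_ , r) , _ , refl ← ∈-map⁻ proj₁ r∈ = r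

  machine : LLBM Σ
  machine = record
    { Γ = K ; Γ-finite = K-finite ; Σ-finite = Σ-finite ; Σ⊆Γ = Σ⊆K
    ; Q = State ; Q-finite = finite-⊎ finite-⊤ internal-finite
    ; q₀ = resting ; F = λ _ → false
    ; δ = rules ; δ-forms = tabulate (wellFormed ∘ rules⁻)
    }

  normalized : Normalized machine
  normalized = record
    { Q-Σ = external
    ; F⊆Q-Σ = λ ()
    ; letterRules = letterRules ∘ rules⁻
    ; εRules = εRules ∘ rules⁻
    ; complete = λ { {inj₂ q} _ X → complete q X }
    }
    where
    letterRules : ∀ {p X a r} → Rules (p , X , just a , r) → T (external p)
    letterRules (read _) = tt

    εRules : ∀ {p X r} → Rules (p , X , nothing , r) → T (not (external p))
    εRules {inj₂ _} _ = tt

    complete : ∀ q X → ∃[ q′ ] ∃[ Y ] ∃[ d ] ((inj₂ q , X , nothing , write q′ Y d) ∈ rules)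
    complete q ⊢       = dead , ⊢ , + , rules⁺ (dieLeft q)
    complete q ⊣       = dead , ⊣ , - , rules⁺ (dieRight q)
    complete q (sym x) = dead , sym x , + , rules⁺ (die q x)

  -- Tapes and configurations of the sweeping machine

  Configuration : Set
  Configuration = Word K State

  _⟶ε_ _⟶ε*_ : Configuration → Configuration → Set
  c ⟶ε c′ = Step machine c nothing c′
  _⟶ε*_ = Star _⟶ε_

  top : List K → Cell K
  top []      = ⊢
  top (x ∷ _) = sym x

  below : List K → List (Cell K)
  below []      = []
  below (_ ∷ u) = top u ∷ below u

  left : List K → List (Cell K)
  left u = top u ∷ below u

  closed : List K → List (Cell K)
  closed v = map sym v ++ ⊣ ∷ []

  -- The tape ⊢ (reverse u) v ⊣ with the head on the cell right of `reverse u`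
  -- (conf) or on the cell left of v (retreat).
  conf retreat : List K → State → List K → Configuration
  conf u q v    = ⟨ left u , q , closed v ⟩
  retreat u q v = ⟨ below u , q , top u ∷ closed v ⟩

  at-rest : List K → Configuration
  at-rest u = conf u resting []

  left-ʳ++ : ∀ u v → left u ʳ++ closed v ≡ ⊢ ∷ closed (u ʳ++ v)
  left-ʳ++ []      v = refl
  left-ʳ++ (x ∷ u) v = left-ʳ++ u (x ∷ v)

  at-rest-configuration : ∀ u → IsConfiguration machine (at-rest u)
  at-rest-configuration u = (λ ()) , reverse u , left-ʳ++ u []

  map-sym-ʳ++ : ∀ w u → map sym w ʳ++ left u ≡ left (w ʳ++ u)
  map-sym-ʳ++ []      u = refl
  map-sym-ʳ++ (x ∷ w) u = map-sym-ʳ++ w (x ∷ u)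

  -- The marker `⊣` occurs only as the last cell of a configuration, so everything before it is `⊢`
  -- followed by symbols.
  configuration-at-⊣ : ∀ {l q r} → IsConfiguration machine ⟨ l , q , ⊣ ∷ r ⟩ →
                       ∃[ u ] (l ≡ left u × r ≡ [])
  configuration-at-⊣ {l} {q} {r} (_ , w , eq) = prefix-∷ (reverse l) refl
    (trans (≡-sym (ʳ++-defn l)) eq)
    where
    split : ∀ l w → l ++ ⊣ ∷ r ≡ closed w → l ≡ map sym w × r ≡ []
    split []      []      refl = refl , refl
    split (_ ∷ []) [] ()
    split (_ ∷ _ ∷ _) [] ()
    split (_ ∷ l) (x ∷ w) eq with refl , eq′ ← ∷-injective eq with refl , refl ← split l w eq′ =
      refl , refl

    -- `reverse l` is generalized to `l′` to allow a case analysis in reading order.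
    prefix-∷ : ∀ l′ → l′ ≡ reverse l → l′ ++ ⊣ ∷ r ≡ ⊢ ∷ closed w →
               ∃[ u ] (l ≡ left u × r ≡ [])
    prefix-∷ (_ ∷ l′) l′≡ eq with refl , eq′ ← ∷-injective eq with refl , refl ← split l′ w eq′ =
      reverse w ,
      trans (≡-sym (reverse-involutive l)) (trans (cong reverse (≡-sym l′≡)) (map-sym-ʳ++ w [])) ,
      refl

  left-injective : ∀ u u′ → left u ≡ left u′ → u ≡ u′
  left-injective []      []       _  = refl
  left-injective (_ ∷ u) (_ ∷ u′) eq with refl , eq′ ← ∷-injective eq =
    cong (_ ∷_) (left-injective u u′ eq′)

  at-rest-injective : ∀ {u u′} → at-rest u ≡ at-rest u′ → u ≡ u′
  at-rest-injective eq = left-injective _ _ (cong Word.left eq)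

  -- Soundness of the sweeping machine

  External : Configuration → Set
  External c = T (external (Word.state c))

  -- Every rule applicable in `dead` leads back to `dead`, which is internal.
  dead-absorbing : ∀ {l r c} → ⟨ l , dead , r ⟩ ⟶ε* c → External c → ⊥
  dead-absorbing ε ()
  dead-absorbing (moveRight m ◅ s) t with rules⁻ m
  ... | die _ _     = dead-absorbing s t
  ... | dieLeft _   = dead-absorbing s t
  dead-absorbing (moveLeft m ◅ s) t with rules⁻ m
  ... | dieRight _  = dead-absorbing s t
  dead-absorbing (erase m ◅ s) t with () ← rules⁻ m

  resting-final : ∀ {l r c} → ⟨ l , resting , r ⟩ ⟶ε* c → ⟨ l , resting , r ⟩ ≡ c
  resting-final ε = refl
  resting-final (moveRight m ◅ _) with () ← rules⁻ m
  resting-final (moveLeft m ◅ _) with () ← rules⁻ m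
  resting-final (erase m ◅ _) with () ← rules⁻ m

  -- Recursion on the sequence of ε-steps, as in the soundness lemmas below: at each step, any rule
  -- other than the intended one leads into `dead`, from which no external configuration is
  -- reachable.
  trimming-sound : ∀ u {c} → retreat u trimming [] ⟶ε* c → External c →
                   ∃[ u′ ] (Trim u u′ × c ≡ at-rest u′)
  bouncing-sound : ∀ u {c} → conf u trimming [] ⟶ε* c → External c →
                   ∃[ u′ ] (Trim u u′ × c ≡ at-rest u′)
  trimming-sound u ε ()
  trimming-sound [] (moveRight m ◅ s) t with rules⁻ m
  ... | dieLeft _ = ⊥-elim (dead-absorbing s t)
  trimming-sound (x ∷ u) (moveRight m ◅ s) t with rules⁻ m
  ... | rest _ n = x ∷ u , stop n , ≡-sym (resting-final s)
  ... | die _ _  = ⊥-elim (dead-absorbing s t)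
  trimming-sound (x ∷ u) (moveLeft m ◅ s) t with () ← rules⁻ m
  trimming-sound (x ∷ u) (erase m ◅ s) t with rules⁻ m
  ... | trim _ n with u′ , u↝u′ , c≡ ← bouncing-sound u s t = u′ , drop n u↝u′ , c≡

  bouncing-sound u ε ()
  bouncing-sound u (moveRight m ◅ s) t with () ← rules⁻ m
  bouncing-sound u (moveLeft m ◅ s) t with rules⁻ m
  ... | back       = trimming-sound u s t
  ... | dieRight _ = ⊥-elim (dead-absorbing s t)

  -- What remains of a computation once a sweep has ended in state `z` with the reversed tape `u`.
  -- It is separated from the run because the recursion along the tape sees only the part of the run
  -- from the current cell onwards.
  After : Z → List K → List K → Set
  After z u u′ = (∃[ z₁ ] (Turn z (just z₁) × Computation z₁ (reverse u) u′)) ⊎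
                 (Turn z nothing × Trim u u′)

  computation : ∀ {z w w₁ z₁ u} → Run Trans z w w₁ z₁ → After z₁ (reverse w₁) u →
                Computation z w u
  computation {w₁ = w₁} {u = u} run (inj₁ (_ , t , c)) =
    again run t (subst (λ w → Computation _ w u) (reverse-involutive w₁) c)
  computation run (inj₂ (t , u↝u′)) = halt run t u↝u′

  mutual
    returning-sound : ∀ {z} u v {c} → retreat u (returning z) v ⟶ε* c → External c →
                      ∃[ u′ ] (Computation z (u ʳ++ v) u′ × c ≡ at-rest u′)
    returning-sound u v ε ()
    returning-sound [] v (moveRight m ◅ s) t with rules⁻ m
    ... | begin _ with _ , _ , u′ , run , after , c≡ ← sweeping-sound [] v s t =
      u′ , computation run after , c≡
    ... | dieLeft _ = ⊥-elim (dead-absorbing s t)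
    returning-sound (x ∷ u) v (moveRight m ◅ s) t with rules⁻ m
    ... | die _ _ = ⊥-elim (dead-absorbing s t)
    returning-sound (x ∷ u) v (moveLeft m ◅ s) t with rules⁻ m
    ... | return _ _ = returning-sound u (x ∷ v) s t
    returning-sound (x ∷ u) v (erase m ◅ s) t with () ← rules⁻ m

    -- The cells of `u` are already rewritten; the run obtained covers only `v`, and its output is
    -- stacked on `u` for the continuation.
    sweeping-sound : ∀ {z} u v {c} → conf u (sweeping z) v ⟶ε* c → External c →
                     ∃[ w₁ ] ∃[ z₁ ] ∃[ u′ ]
                       (Run Trans z v w₁ z₁ × After z₁ (w₁ ʳ++ u) u′ × c ≡ at-rest u′)
    sweeping-sound u v ε ()
    sweeping-sound u [] (moveRight m ◅ s) t with () ← rules⁻ m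
    sweeping-sound u [] (moveLeft m ◅ s) t with rules⁻ m
    ... | turn {m = just _} n
      with u′ , comp , c≡ ← returning-sound u [] s t =
      [] , _ , u′ , [] , inj₁ (_ , n , comp) , c≡
    ... | turn {m = nothing} n
      with u′ , u↝u′ , c≡ ← trimming-sound u s t =
      [] , _ , u′ , [] , inj₂ (n , u↝u′) , c≡
    ... | dieRight _ = ⊥-elim (dead-absorbing s t)
    sweeping-sound u (x ∷ v) (moveRight m ◅ s) t with rules⁻ m
    ... | sweep {y = y} n
      with w₁ , z₁ , u′ , run , after , c≡ ← sweeping-sound (y ∷ u) v s t =
      y ∷ w₁ , z₁ , u′ , n ∷ run , after , c≡
    ... | die _ _ = ⊥-elim (dead-absorbing s t)
    sweeping-sound u (x ∷ v) (moveLeft m ◅ s) t with () ← rules⁻ m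
    sweeping-sound u (x ∷ v) (erase m ◅ s) t with () ← rules⁻ m

  checking-sound : ∀ {z} u v {c} → retreat u (checking z) v ⟶ε* c → External c →
                   Trimmed u × ∃[ u′ ] (Computation z (u ʳ++ v) u′ × c ≡ at-rest u′)
  checking-sound u v ε ()
  checking-sound [] v (moveRight m ◅ s) t with rules⁻ m
  ... | dieLeft _ = ⊥-elim (dead-absorbing s t)
  checking-sound (x ∷ u) v (moveRight m ◅ s) t with rules⁻ m
  ... | die _ _ = ⊥-elim (dead-absorbing s t)
  checking-sound (x ∷ u) v (moveLeft m ◅ s) t with rules⁻ m
  ... | check _ _ n = trimmed n , returning-sound u (x ∷ v) s t
  checking-sound (x ∷ u) v (erase m ◅ s) t with () ← rules⁻ m

  inserted-sound : ∀ {z} u x {c} → conf u (inserted z) (x ∷ []) ⟶ε* c → External c →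
                   Trimmed u × ∃[ u′ ] (Computation z (u ʳ++ (x ∷ [])) u′ × c ≡ at-rest u′)
  inserted-sound u x ε ()
  inserted-sound u x (moveRight m ◅ s) t with rules⁻ m
  ... | die _ _ = ⊥-elim (dead-absorbing s t)
  inserted-sound u x (moveLeft m ◅ s) t with rules⁻ m
  ... | skip _ _ = checking-sound u (x ∷ []) s t
  inserted-sound u x (erase m ◅ s) t with () ← rules⁻ m

  -- The only letter rule is `read`, which forces the head of the source onto `⊣`. That the source
  -- is trimmed is due to `check`, and the external target can only be reached through `rest`.
  edge-sound : ∀ {c a c′} → transitionGraph machine normalized c a c′ →
               ∃[ u ] ∃[ u′ ] (c ≡ at-rest u × c′ ≡ at-rest u′ × Trimmed u ×
                               Computation (start a) (u ʳ++ (blank ∷ [])) u′)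
  edge-sound (_ , _ , _ , moveRight m , _) with () ← rules⁻ m
  edge-sound (_ , _ , _ , moveLeft m , _) with () ← rules⁻ m
  edge-sound {⟨ l , q , _ ⟩} ((c-conf , _) , (_ , t) , _ , extend m , s) with rules⁻ m
  ... | read _ with u , refl , refl ← configuration-at-⊣ {l} {q} c-conf
               with u-trimmed , u′ , comp , c′≡ ← inserted-sound u blank s t =
    u , u′ , refl , c′≡ , u-trimmed , comp

  -- Completeness of the sweeping machine

  returning-complete : ∀ z u v → retreat u (returning z) v ⟶ε* conf [] (sweeping z) (u ʳ++ v)
  returning-complete z []      v = moveRight (rules⁺ (begin z)) ◅ ε
  returning-complete z (x ∷ u) v =
    moveLeft (rules⁺ (return z x)) ◅ returning-complete z u (x ∷ v)

  sweeping-complete : ∀ {z v w₁ z₁} u → Run Trans z v w₁ z₁ →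
                      conf u (sweeping z) v ⟶ε* conf (w₁ ʳ++ u) (sweeping z₁) []
  sweeping-complete u []        = ε
  sweeping-complete u (t ∷ run) = moveRight (rules⁺ (sweep t)) ◅ sweeping-complete _ run

  trimming-complete : ∀ {u u′} → Trim u u′ → retreat u trimming [] ⟶ε* at-rest u′
  trimming-complete (stop n)   = moveRight (rules⁺ (rest _ n)) ◅ ε
  trimming-complete (drop n t) =
    erase (rules⁺ (trim _ n)) ◅ moveLeft (rules⁺ back) ◅ trimming-complete t

  computation-complete : ∀ {z w u} → Computation z w u →
                         conf [] (sweeping z) w ⟶ε* at-rest u
  computation-complete (again {w₁} {z₂ = z₂} run t comp) =
    sweeping-complete [] run ◅◅ moveLeft (rules⁺ (turn t)) ◅
    subst (λ w → retreat (reverse w₁) (returning z₂) [] ⟶ε* conf [] (sweeping z₂) w)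
      (reverse-involutive w₁) (returning-complete z₂ (reverse w₁) []) ◅◅
    computation-complete comp
  computation-complete (halt run t u↝u′) =
    sweeping-complete [] run ◅◅ moveLeft (rules⁺ (turn t)) ◅ trimming-complete u↝u′

  edge-complete : ∀ {a u u′} → Trimmed u → Computation (start a) (u ʳ++ (blank ∷ [])) u′ →
                  transitionGraph machine normalized (at-rest u) a (at-rest u′)
  edge-complete {a} {x ∷ u} {u′} (trimmed n) comp =
    (at-rest-configuration (x ∷ u) , tt) , (at-rest-configuration u′ , tt) , _ ,
    extend (rules⁺ (read a)) ,
    (moveLeft (rules⁺ (skip _ _)) ◅ moveLeft (rules⁺ (check _ _ n)) ◅
     returning-complete _ u (x ∷ blank ∷ []) ◅◅ computation-complete comp)

-- One layer: transducing configurations of a single machine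

pad : ℕ → List A → List (Maybe A)
pad k xs = map just xs ++ replicate k nothing

pad-snoc : ∀ k (xs : List A) → pad k xs ++ nothing ∷ [] ≡ pad (suc k) xs
pad-snoc zero    []       = refl
pad-snoc (suc k) []       = cong (nothing ∷_) (pad-snoc k [])
pad-snoc k       (x ∷ xs) = cong (just x ∷_) (pad-snoc k xs)

-- The last entry is blank and hence belongs to the padding, not to `xs`.
pad-unsnoc : ∀ ys k (xs : List A) → ys ++ nothing ∷ [] ≡ pad k xs →
             ∃[ j ] (k ≡ suc j × ys ≡ pad j xs)
pad-unsnoc []       (suc zero) [] refl = zero , refl , refl
pad-unsnoc []       zero    (x ∷ xs) ()
pad-unsnoc []       (suc k) (x ∷ xs) ()
pad-unsnoc (_ ∷ []) zero [] ()
pad-unsnoc (y ∷ ys) (suc k) [] eq with refl , eq′ ← ∷-injective eq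
  with j , refl , refl ← pad-unsnoc ys k [] eq′ = suc j , refl , refl
pad-unsnoc (y ∷ ys) k (x ∷ xs) eq with refl , eq′ ← ∷-injective eq
  with j , refl , refl ← pad-unsnoc ys k xs eq′ = j , refl , refl

-- The padding begins at the first `nothing`, whatever its length.
pad-injective : ∀ k l (xs ys : List A) → pad k xs ≡ pad l ys → xs ≡ ys
pad-injective k l [] [] _ = refl
pad-injective zero l [] (y ∷ ys) ()
pad-injective (suc k) l [] (y ∷ ys) ()
pad-injective k zero (x ∷ xs) [] ()
pad-injective k (suc l) (x ∷ xs) [] ()
pad-injective k l (x ∷ xs) (y ∷ ys) eq with refl , eq′ ← ∷-injective eq =
  cong (x ∷_) (pad-injective k l xs ys eq′)

module Layer {Σ : Set} (M : LLBM Σ) (N : Normalized M) where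

  open LLBM M
  open Normalized N

  Symbol K : Set
  Symbol = Q ⊎ Cell Γ
  K = Maybe Symbol

  pattern ctrl q = just (inj₁ q)
  pattern cell X = just (inj₂ X)

  Configuration : Set
  Configuration = Word Γ Q

  External : Configuration → Set
  External c = IsConfiguration M c × T (Q-Σ (Word.state c))

  letters : Configuration → List Symbol
  letters ⟨ u , q , v ⟩ = map inj₂ u ʳ++ (inj₁ q ∷ map inj₂ v)

  tape : List (Cell Γ) → Q → List (Cell Γ) → List Symbol
  tape α q v = map inj₂ α ++ inj₁ q ∷ map inj₂ v

  letters-ʳ++ : ∀ α u t → map inj₂ (α ʳ++ u) ʳ++ t ≡ map {B = Symbol} inj₂ u ʳ++ (map inj₂ α ++ t)
  letters-ʳ++ []      u t = refl
  letters-ʳ++ (X ∷ α) u t = letters-ʳ++ α (X ∷ u) t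

  letters-reverse : ∀ α q v → letters ⟨ reverse α , q , v ⟩ ≡ tape α q v
  letters-reverse α q v = letters-ʳ++ α [] _

  letters≡tape : ∀ c → letters c ≡ tape (reverse (Word.left c)) (Word.state c) (Word.right c)
  letters≡tape ⟨ u , q , v ⟩ = trans
    (cong (λ u → letters ⟨ u , q , v ⟩) (≡-sym (reverse-involutive u)))
    (letters-reverse (reverse u) q v)

  letters-nonempty : ∀ c → ∃[ x ] ∃[ xs ] letters c ≡ x ∷ xs
  letters-nonempty c with reverse (Word.left c) | letters≡tape c
  ... | []    | eq = _ , _ , eq
  ... | _ ∷ _ | eq = _ , _ , eq

  map-inj₂-injective : ∀ v v′ → map {B = Symbol} inj₂ v ≡ map inj₂ v′ → v ≡ v′
  map-inj₂-injective []      []        _  = refl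
  map-inj₂-injective (X ∷ v) (X′ ∷ v′) eq with refl , eq′ ← ∷-injective eq =
    cong (X ∷_) (map-inj₂-injective v v′ eq′)

  -- The position of the head is determined by the only letter of the form `inj₁`.
  tape-injective : ∀ α α′ {q q′ v v′} → tape α q v ≡ tape α′ q′ v′ → α ≡ α′ × q ≡ q′ × v ≡ v′
  tape-injective [] [] eq with refl , eq′ ← ∷-injective eq =
    refl , refl , map-inj₂-injective _ _ eq′
  tape-injective (X ∷ α) (X′ ∷ α′) eq with refl , eq′ ← ∷-injective eq
    with refl , refl , refl ← tape-injective α α′ eq′ = refl , refl , refl

  letters-injective : ∀ {c c′} → letters c ≡ letters c′ → c ≡ c′
  letters-injective {c@(⟨ u , _ , _ ⟩)} {c′@(⟨ u′ , _ , _ ⟩)} eq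
    with eq₁ , refl , refl ← tape-injective _ _
           (trans (≡-sym (letters≡tape c)) (trans eq (letters≡tape c′)))
    with refl ← reverse-injective {x = u} {u′} eq₁ = refl

  -- The first five states read a configuration: whether ⊢ has been read, then
  -- the same with the control state already read, then the padding after ⊣.
  State : Set
  State = Fin 5 ⊎ Maybe Σ ⊎ ⊤ ⊎ (K × K) ⊎ (K × K × K × K) ⊎ K ⊎ (K × K × K) ⊎ K ⊎ ⊥

  pattern unopened            = #0 zero
  pattern opened              = #0 (suc zero)
  pattern unopened′           = #0 (suc (suc zero))
  pattern opened′             = #0 (suc (suc (suc zero)))
  pattern padded              = #0 (suc (suc (suc (suc zero))))
  pattern scanning x          = #1 x
  pattern copying             = #2 tt
  pattern emitting x y        = #3 (x , y)
  pattern emitting₂ x y x′ y′ = #4 (x , y , x′ , y′)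
  pattern shiftingLeft x      = #5 x
  pattern inserting x y z     = #6 (x , y , z)
  pattern shiftingRight z     = #7 z

  -- Nondeterminism chooses where `scanning` stops and which rule is applied. The rule's remaining
  -- cells are kept in the state and compared with the input by the following transitions. `left`
  -- has to act one cell before the control state, since the output control state precedes `C`.
  data Trans : State → K → K → State → Set where
    open⊢    : Trans unopened (cell ⊢) (cell ⊢) opened
    control  : ∀ q → T (Q-Σ q) → Trans unopened (ctrl q) (ctrl q) unopened′
    inside   : ∀ A → Trans opened (cell (sym A)) (cell (sym A)) opened
    control′ : ∀ q → T (Q-Σ q) → Trans opened (ctrl q) (ctrl q) opened′
    open⊢′   : Trans unopened′ (cell ⊢) (cell ⊢) opened′
    inside′  : ∀ A → Trans opened′ (cell (sym A)) (cell (sym A)) opened′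
    close⊣   : Trans opened′ (cell ⊣) (cell ⊣) padded
    padding  : Trans padded nothing nothing padded
    scan     : ∀ x X → Trans (scanning x) (cell X) (cell X) (scanning x)
    -- A layer may idle while the other one makes an ε-step, but it cannot skip a letter.
    stay     : ∀ q → Trans (scanning nothing) (ctrl q) (ctrl q) copying
    copy     : ∀ x → Trans copying x x copying
    emit     : ∀ x y → Trans (emitting x y) x y copying
    emit₂    : ∀ x y x′ y′ → Trans (emitting₂ x y x′ y′) x y (emitting x′ y′)
    -- The output is one cell ahead of the input, so it is guessed here and
    -- verified by the next state.
    shift←   : ∀ x y → Trans (shiftingLeft x) x y (shiftingLeft y)
    insert   : ∀ x y z → Trans (inserting x y z) x y (shiftingRight z)
    shift→   : ∀ x y → Trans (shiftingRight y) x y (shiftingRight x)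
    right    : ∀ {p X x q Y} → (p , X , x , write q Y +) ∈ δ →
               Trans (scanning x) (ctrl p) (cell Y) (emitting (cell X) (ctrl q))
    left     : ∀ {p X x q Y} C → (p , X , x , write q Y -) ∈ δ →
               Trans (scanning x) (cell C) (ctrl q) (emitting₂ (ctrl p) (cell C) (cell X) (cell Y))
    grow     : ∀ {p X x q A Z} → (p , X , x , insert q A Z) ∈ δ →
               Trans (scanning x) (ctrl p) (ctrl q) (inserting (cell X) (cell (sym A)) (cell Z))
    shrink   : ∀ {p X x q} → (p , X , x , delete q) ∈ δ →
               Trans (scanning x) (ctrl p) (ctrl q) (shiftingLeft (cell X))

  -- A shift may end only with a blank in its buffer: to the right no cell is then lost, and to the
  -- left the last guess is the blank beyond the end of the tape.
  data Accepting : State → Set where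
    ended    : Accepting padded
    copied   : Accepting copying
    shifted← : Accepting (shiftingLeft nothing)
    shifted→ : Accepting (shiftingRight nothing)

  accepting-enumerable : Enumerable (∃ Accepting)
  accepting-enumerable =
    (_ , ended) ∷ (_ , copied) ∷ (_ , shifted←) ∷ (_ , shifted→) ∷ [] ,
    λ { (_ , ended) → here refl ; (_ , copied) → there (here refl)
      ; (_ , shifted←) → there (there (here refl))
      ; (_ , shifted→) → there (there (there (here refl))) }

  K-finite : Finite K
  K-finite = finite-Maybe (finite-⊎ Q-finite (finite-Cell Γ-finite))

  state-finite : Finite State
  state-finite =
    finite-⊎ (_ , ↔-refl) (finite-⊎ (finite-Maybe Σ-finite) (finite-⊎ finite-⊤ (finite-⊎ K²
    (finite-⊎ (finite-× K-finite (finite-× K-finite K²)) (finite-⊎ K-finite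
    (finite-⊎ (finite-× K-finite K²) (finite-⊎ K-finite finite-⊥)))))))
    where
    K² : Finite (K × K)
    K² = finite-× K-finite K-finite

  trans-enumerable : Enumerable (∃[ s ] ∃[ x ] ∃[ y ] ∃[ s₁ ] Trans s x y s₁)
  trans-enumerable = enumerable-image {A = Code}
    (λ { (#0 (#0 tt))      → _ , _ , _ , _ , open⊢
       ; (#0 (#1 (q , t))) → _ , _ , _ , _ , control q t
       ; (#0 (#2 A))       → _ , _ , _ , _ , inside A
       ; (#0 (#3 (q , t))) → _ , _ , _ , _ , control′ q t
       ; (#0 (#4 tt))      → _ , _ , _ , _ , open⊢′
       ; (#0 (#5 A))       → _ , _ , _ , _ , inside′ A
       ; (#0 (#6 tt))      → _ , _ , _ , _ , close⊣
       ; (#0 (#7 tt))      → _ , _ , _ , _ , padding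
       ; (#1 (#0 (x , X))) → _ , _ , _ , _ , scan x X
       ; (#1 (#1 q))       → _ , _ , _ , _ , stay q
       ; (#1 (#2 x))       → _ , _ , _ , _ , copy x
       ; (#1 (#3 (x , y))) → _ , _ , _ , _ , emit x y
       ; (#1 (#4 (x , y , x′ , y′))) → _ , _ , _ , _ , emit₂ x y x′ y′
       ; (#1 (#5 (x , y))) → _ , _ , _ , _ , shift← x y
       ; (#1 (#6 (x , y , z))) → _ , _ , _ , _ , insert x y z
       ; (#1 (#7 (x , y))) → _ , _ , _ , _ , shift→ x y
       ; (#2 (((_ , _ , _ , write _ _ +) , m) , _)) → _ , _ , _ , _ , right m
       ; (#2 (((_ , _ , _ , write _ _ -) , m) , C)) → _ , _ , _ , _ , left C m
       ; (#2 (((_ , _ , _ , insert _ _ _) , m) , _)) → _ , _ , _ , _ , grow m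
       ; (#2 (((_ , _ , _ , delete _) , m) , _)) → _ , _ , _ , _ , shrink m
       })
    (λ { (_ , _ , _ , _ , open⊢)         → #0 (#0 tt) , refl
       ; (_ , _ , _ , _ , control q t)   → #0 (#1 (q , t)) , refl
       ; (_ , _ , _ , _ , inside A)      → #0 (#2 A) , refl
       ; (_ , _ , _ , _ , control′ q t)  → #0 (#3 (q , t)) , refl
       ; (_ , _ , _ , _ , open⊢′)        → #0 (#4 tt) , refl
       ; (_ , _ , _ , _ , inside′ A)     → #0 (#5 A) , refl
       ; (_ , _ , _ , _ , close⊣)        → #0 (#6 tt) , refl
       ; (_ , _ , _ , _ , padding)       → #0 (#7 tt) , refl
       ; (_ , _ , _ , _ , scan x X)      → #1 (#0 (x , X)) , refl
       ; (_ , _ , _ , _ , stay q)        → #1 (#1 q) , refl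
       ; (_ , _ , _ , _ , copy x)        → #1 (#2 x) , refl
       ; (_ , _ , _ , _ , emit x y)      → #1 (#3 (x , y)) , refl
       ; (_ , _ , _ , _ , emit₂ x y x′ y′) → #1 (#4 (x , y , x′ , y′)) , refl
       ; (_ , _ , _ , _ , shift← x y)    → #1 (#5 (x , y)) , refl
       ; (_ , _ , _ , _ , insert x y z)  → #1 (#6 (x , y , z)) , refl
       ; (_ , _ , _ , _ , shift→ x y)    → #1 (#7 (x , y)) , refl
       -- The cell component of the code is the `C` of `left`; for the other rules `⊢` is a default
       -- and any cell would be a preimage.
       ; (_ , _ , _ , _ , right m)       → #2 ((_ , m) , ⊢) , refl
       ; (_ , _ , _ , _ , left C m)      → #2 ((_ , m) , C) , refl
       ; (_ , _ , _ , _ , grow m)        → #2 ((_ , m) , ⊢) , refl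
       ; (_ , _ , _ , _ , shrink m)      → #2 ((_ , m) , ⊢) , refl
       })
    (enumerable-⊎ (finite⇒enumerable
      (finite-⊎ finite-⊤ (finite-⊎ Q-Σ-finite (finite-⊎ Γ-finite (finite-⊎ Q-Σ-finite
      (finite-⊎ finite-⊤ (finite-⊎ Γ-finite (finite-⊎ finite-⊤ (finite-⊎ finite-⊤ finite-⊥)))))))))
    (enumerable-⊎ (finite⇒enumerable
      (finite-⊎ (finite-× (finite-Maybe Σ-finite) (finite-Cell Γ-finite)) (finite-⊎ Q-finite
      (finite-⊎ K-finite (finite-⊎ K² (finite-⊎ (finite-× K-finite (finite-× K-finite K²))
      (finite-⊎ K² (finite-⊎ (finite-× K-finite K²) (finite-⊎ K² finite-⊥)))))))))
    (enumerable-⊎ (enumerable-× (enumerable-∈ δ) (finite⇒enumerable (finite-Cell Γ-finite)))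
      (finite⇒enumerable finite-⊥))))
    where
    Code : Set
    Code =
      (⊤ ⊎ ⟦ Q-Σ ⟧ ⊎ Γ ⊎ ⟦ Q-Σ ⟧ ⊎ ⊤ ⊎ Γ ⊎ ⊤ ⊎ ⊤ ⊎ ⊥) ⊎
      ((Maybe Σ × Cell Γ) ⊎ Q ⊎ K ⊎ (K × K) ⊎ (K × K × K × K) ⊎ (K × K) ⊎ (K × K × K) ⊎ (K × K) ⊎ ⊥) ⊎
      ((∃[ r ] r ∈ δ) × Cell Γ) ⊎ ⊥
    Q-Σ-finite : Finite ⟦ Q-Σ ⟧
    Q-Σ-finite = finite-⟦⟧ Q-finite Q-Σ
    K² : Finite (K × K)
    K² = finite-× K-finite K-finite

  -- Sweeps that check for an external configuration

  Sweep : State → List K → List K → Set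
  Sweep s w w′ = ∃[ s₁ ] (Run Trans s w w′ s₁ × Accepting s₁)

  padding-sound : ∀ {w w′} → Sweep padded w w′ → w ≡ w′ × ∃[ k ] w ≡ pad k []
  padding-sound (_ , [] , _) = refl , zero , refl
  padding-sound (_ , padding ∷ run , a) with refl , k , refl ← padding-sound (_ , run , a) =
    refl , suc k , refl

  opened′-sound : ∀ {w w′} → Sweep opened′ w w′ →
                  w ≡ w′ × ∃[ γ ] ∃[ k ] w ≡ pad k (map inj₂ (map sym γ ++ ⊣ ∷ []))
  opened′-sound (_ , [] , ())
  opened′-sound (_ , inside′ A ∷ run , a) with refl , γ , k , refl ← opened′-sound (_ , run , a) =
    refl , A ∷ γ , k , refl
  opened′-sound (_ , close⊣ ∷ run , a) with refl , k , refl ← padding-sound (_ , run , a) =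
    refl , [] , k , refl

  -- `⊣` can be read only in `opened′`, hence after the control state; this yields `v ≢ []`.
  opened-sound : ∀ {w w′} → Sweep opened w w′ →
                 w ≡ w′ × ∃[ α ] ∃[ q ] ∃[ v ] ∃[ γ ] ∃[ k ]
                   (w ≡ pad k (tape α q v) × T (Q-Σ q) × v ≢ [] × α ++ v ≡ map sym γ ++ ⊣ ∷ [])
  opened-sound (_ , [] , ())
  opened-sound (_ , inside A ∷ run , a)
    with refl , α , q , v , γ , k , refl , t , v≢[] , eq ← opened-sound (_ , run , a) =
    refl , sym A ∷ α , q , v , A ∷ γ , k , refl , t , v≢[] , cong (sym A ∷_) eq
  opened-sound (_ , control′ q t ∷ run , a) with opened′-sound (_ , run , a)
  ... | refl , [] , k , refl = refl , [] , q , _ , [] , k , refl , t , (λ ()) , refl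
  ... | refl , A ∷ γ , k , refl = refl , [] , q , _ , A ∷ γ , k , refl , t , (λ ()) , refl

  check-sound : ∀ {w w′} → Sweep unopened w w′ →
                w ≡ w′ × ∃[ c ] ∃[ k ] (w ≡ pad k (letters c) × External c)
  check-sound (_ , [] , ())
  check-sound (_ , open⊢ ∷ run , a)
    with refl , α , q , v , γ , k , refl , t , v≢[] , eq ← opened-sound (_ , run , a) =
    refl , ⟨ reverse (⊢ ∷ α) , q , v ⟩ , k , cong (pad k) (≡-sym (letters-reverse (⊢ ∷ α) q v)) ,
    (v≢[] , γ , trans (ʳ++-ʳ++′ (⊢ ∷ α) v) (cong (⊢ ∷_) eq)) , t
    where
    ʳ++-ʳ++′ : ∀ (xs ys : List (Cell Γ)) → reverse xs ʳ++ ys ≡ xs ++ ys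
    ʳ++-ʳ++′ xs ys = trans (ʳ++-defn (reverse xs)) (cong (_++ ys) (reverse-involutive xs))
  check-sound (_ , control q t ∷ [] , ())
  check-sound (_ , control q t ∷ open⊢′ ∷ run , a)
    with refl , γ , k , refl ← opened′-sound (_ , run , a) =
    refl , ⟨ [] , q , _ ⟩ , k , refl , ((λ ()) , γ , refl) , t

  padding-complete : ∀ k → Sweep padded (pad k []) (pad k [])
  padding-complete zero    = _ , [] , ended
  padding-complete (suc k) with _ , run , a ← padding-complete k = _ , padding ∷ run , a

  opened′-complete : ∀ γ k → let w = pad k (map inj₂ (map sym γ ++ ⊣ ∷ [])) in Sweep opened′ w w
  opened′-complete []      k with _ , run , a ← padding-complete k = _ , close⊣ ∷ run , a
  opened′-complete (A ∷ γ) k with _ , run , a ← opened′-complete γ k = _ , inside′ A ∷ run , a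

  opened-complete : ∀ α {q v} γ k → T (Q-Σ q) → v ≢ [] → α ++ v ≡ map sym γ ++ ⊣ ∷ [] →
                    let w = pad k (tape α q v) in Sweep opened w w
  opened-complete [] γ k t _ refl with _ , run , a ← opened′-complete γ k =
    _ , control′ _ t ∷ run , a
  -- Here `⊣` would lie left of the control state and leave nothing for `v`.
  opened-complete (X ∷ []) [] k t v≢[] refl = ⊥-elim (v≢[] refl)
  opened-complete (X ∷ Y ∷ α) [] k t _ ()
  opened-complete (X ∷ α) (A ∷ γ) k t v≢[] eq with refl , eq′ ← ∷-injective eq
    with _ , run , a ← opened-complete α γ k t v≢[] eq′ = _ , inside A ∷ run , a

  unopened-complete : ∀ α {q v} γ k → T (Q-Σ q) → v ≢ [] → α ++ v ≡ ⊢ ∷ map sym γ ++ ⊣ ∷ [] →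
                      let w = pad k (tape α q v) in Sweep unopened w w
  unopened-complete [] γ k t _ refl with _ , run , a ← opened′-complete γ k =
    _ , control _ t ∷ open⊢′ ∷ run , a
  unopened-complete (X ∷ α) γ k t v≢[] eq with refl , eq′ ← ∷-injective eq
    with _ , run , a ← opened-complete α γ k t v≢[] eq′ = _ , open⊢ ∷ run , a

  check-complete : ∀ c k → External c → Sweep unopened (pad k (letters c)) (pad k (letters c))
  check-complete c@(⟨ u , q , v ⟩) k ((v≢[] , γ , eq) , t) =
    subst (λ w → Sweep unopened (pad k w) (pad k w)) (≡-sym (letters≡tape c))
      (unopened-complete (reverse u) γ k t v≢[] (trans (≡-sym (ʳ++-defn u)) eq))

  -- Sweeps that perform a step

  copying-sound : ∀ {w w′ s} → Run Trans copying w w′ s → w ≡ w′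
  copying-sound []             = refl
  copying-sound (copy x ∷ run) = cong (x ∷_) (copying-sound run)

  copying-complete : ∀ w → Run Trans copying w w copying
  copying-complete []      = []
  copying-complete (x ∷ w) = copy x ∷ copying-complete w

  -- `x` is the output that still awaits verification. One equation expresses both that all guesses
  -- are right and that a blank enters at the right end.
  shiftingLeft-sound : ∀ {x w w′} → Sweep (shiftingLeft x) w w′ → x ∷ w′ ≡ w ++ nothing ∷ []
  shiftingLeft-sound (_ , [] , shifted←) = refl
  shiftingLeft-sound (_ , shift← x y ∷ run , a) = cong (x ∷_) (shiftingLeft-sound (_ , run , a))

  shiftingLeft-complete : ∀ {x} w {w′} → x ∷ w′ ≡ w ++ nothing ∷ [] → Sweep (shiftingLeft x) w w′
  shiftingLeft-complete []          refl = _ , [] , shifted←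
  shiftingLeft-complete (x ∷ [])    refl = _ , shift← x nothing ∷ [] , shifted←
  shiftingLeft-complete (x ∷ y ∷ w) refl with _ , run , a ← shiftingLeft-complete (y ∷ w) refl =
    _ , shift← x y ∷ run , a

  -- `x` is the cell held back; the blank in the equation is the one pushed out at the right end.
  shiftingRight-sound : ∀ {x w w′} → Sweep (shiftingRight x) w w′ → x ∷ w ≡ w′ ++ nothing ∷ []
  shiftingRight-sound (_ , [] , shifted→) = refl
  shiftingRight-sound (_ , shift→ x y ∷ run , a) = cong (y ∷_) (shiftingRight-sound (_ , run , a))

  shiftingRight-complete : ∀ {x w} w′ → x ∷ w ≡ w′ ++ nothing ∷ [] → Sweep (shiftingRight x) w w′
  shiftingRight-complete []           refl = _ , [] , shifted→
  shiftingRight-complete (y ∷ [])     refl = _ , shift→ nothing y ∷ [] , shifted→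
  shiftingRight-complete (y ∷ x ∷ w′) refl with _ , run , a ← shiftingRight-complete (x ∷ w′) refl =
    _ , shift→ x y ∷ run , a

  Move : Maybe Σ → Configuration → Configuration → Set
  Move x c c′ = Step M c x c′ ⊎ (x ≡ nothing × c ≡ c′)

  -- The cells left of the transducer are an arbitrary `u`, onto which the recursion on `α` pushes
  -- each scanned cell.
  scanning-sound : ∀ {x} α {q} v k {w′} → Sweep (scanning x) (pad k (tape α q v)) w′ →
                   ∃[ α′ ] ∃[ q′ ] ∃[ v′ ] ∃[ k′ ]
                     (w′ ≡ pad k′ (tape α′ q′ v′) ×
                      (∀ u → Move x ⟨ α ʳ++ u , q , v ⟩ ⟨ α′ ʳ++ u , q′ , v′ ⟩))
  scanning-sound [] v k (_ , stay q ∷ run , _) with refl ← copying-sound run =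
    [] , q , v , k , refl , λ _ → inj₂ (refl , refl)
  -- Without a cell under the head the state still expects `X`, which neither the end of the tape
  -- nor a blank provides.
  scanning-sound [] [] zero (_ , right m ∷ [] , ())
  scanning-sound [] [] (suc k) (_ , right m ∷ () ∷ _ , _)
  scanning-sound [] (X ∷ v) k (_ , right {q = q} {Y} m ∷ emit _ _ ∷ run , _)
    with refl ← copying-sound run =
    Y ∷ [] , q , v , k , refl , λ _ → inj₁ (moveRight m)
  scanning-sound [] v k {w′ = _ ∷ w′} (_ , shrink {X = X} {q = q} m ∷ run , a)
    with v | trans (shiftingLeft-sound (_ , run , a)) (pad-snoc k (map inj₂ v))
  ... | []     | ()
  -- Well-formedness ensures that the deleted cell is a symbol and the label is ε. The freed cell
  -- becomes padding, hence `suc k`.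
  ... | Z ∷ v₁ | eq with refl , refl ← ∷-injective eq with deleteSym ← lookup δ-forms m =
    [] , q , v₁ , suc k , refl , λ _ → inj₁ (erase m)
  scanning-sound [] [] zero (_ , grow m ∷ [] , ())
  scanning-sound [] [] (suc k) (_ , grow m ∷ () ∷ _ , _)
  scanning-sound [] (X ∷ v) k {w′ = _ ∷ _ ∷ w′} (_ , grow {q = q} {A} {Z} m ∷ insert _ _ _ ∷ run , a)
    -- The blank pushed out was padding, so `k` is positive and one blank fewer remains.
    with k′ , refl , refl ← pad-unsnoc w′ k (map inj₂ (Z ∷ v))
           (≡-sym (shiftingRight-sound (_ , run , a)))
    -- Well-formedness identifies the cell `Z` of the right-hand side with the cell `X` read.
    with lookup δ-forms m
  ... | insertSym = [] , q , sym A ∷ X ∷ v , k′ , refl , λ _ → inj₁ (extend m)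
  ... | insertEnd = [] , q , sym A ∷ X ∷ v , k′ , refl , λ _ → inj₁ (extend m)
  scanning-sound (C ∷ α) v k (_ , scan _ _ ∷ run , a)
    with α′ , q′ , v′ , k′ , refl , move ← scanning-sound α v k (_ , run , a) =
    C ∷ α′ , q′ , v′ , k′ , refl , λ u → move (C ∷ u)
  scanning-sound (C ∷ []) [] zero (_ , left _ m ∷ emit₂ _ _ _ _ ∷ [] , ())
  scanning-sound (C ∷ []) [] (suc k) (_ , left _ m ∷ emit₂ _ _ _ _ ∷ () ∷ _ , _)
  scanning-sound (C ∷ []) (X ∷ v) k (_ , left {q = q} {Y} _ m ∷ emit₂ _ _ _ _ ∷ emit _ _ ∷ run , _)
    with refl ← copying-sound run =
    [] , q , C ∷ Y ∷ v , k , refl , λ _ → inj₁ (moveLeft m)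
  scanning-sound (C ∷ _ ∷ _) v k (_ , left _ m ∷ () ∷ _ , _)

  step-sound : ∀ {x c k w′} → Sweep (scanning x) (pad k (letters c)) w′ →
               ∃[ c′ ] ∃[ k′ ] (w′ ≡ pad k′ (letters c′) × Move x c c′)
  step-sound {x} {c@(⟨ u , q , v ⟩)} {k} {w′} s
    with α′ , q′ , v′ , k′ , refl , move ← scanning-sound (reverse u) v k
           (subst (λ w → Sweep (scanning x) (pad k w) w′) (letters≡tape c) s) =
    ⟨ reverse α′ , q′ , v′ ⟩ , k′ , cong (pad k′) (≡-sym (letters-reverse α′ q′ v′)) ,
    subst (λ u → Move x ⟨ u , q , v ⟩ _) (reverse-involutive u) (move [])

  scanning-complete : ∀ {x k k′ t t′} u → Sweep (scanning x) (pad k t) (pad k′ t′) →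
                      Sweep (scanning x) (pad k (map inj₂ u ʳ++ t)) (pad k′ (map inj₂ u ʳ++ t′))
  scanning-complete []      s             = s
  scanning-complete (X ∷ u) (_ , run , a) = scanning-complete u (_ , scan _ X ∷ run , a)

  -- Reading a letter may consume one blank.
  slack : Maybe Σ → ℕ → ℕ
  slack nothing  k = k
  slack (just _) k = suc k

  -- Only `extend` lengthens the word, and it carries a letter. One blank per letter is therefore
  -- enough, and ε-steps need none.
  step-complete : ∀ {x c c′} k → Step M c x c′ →
                  ∃[ k′ ] Sweep (scanning x) (pad (slack x k) (letters c)) (pad k′ (letters c′))
  step-complete {x} k (moveRight {u} {v = v} m) =
    _ , scanning-complete u (_ , right m ∷ emit _ _ ∷ copying-complete _ , copied)
  step-complete {x} k (moveLeft {u} m) =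
    _ , scanning-complete u (_ , left _ m ∷ emit₂ _ _ _ _ ∷ emit _ _ ∷ copying-complete _ , copied)
  step-complete k (erase {u} {v = v} m)
    with _ , run , a ← shiftingLeft-complete (pad k (map inj₂ (sym _ ∷ v)))
                         (≡-sym (pad-snoc k (map inj₂ (sym _ ∷ v)))) =
    suc k , scanning-complete u (_ , shrink m ∷ run , a)
  step-complete k (extend {u} {X = X} {v = v} m)
    with _ , run , a ← shiftingRight-complete (pad k (map inj₂ (X ∷ v)))
                         (≡-sym (pad-snoc k (map inj₂ (X ∷ v)))) =
    k , scanning-complete u (_ , grow m ∷ insert _ _ _ ∷ run , a)

  stay-complete : ∀ c k → Sweep (scanning nothing) (pad k (letters c)) (pad k (letters c))
  stay-complete ⟨ u , q , v ⟩ k = scanning-complete u (_ , stay q ∷ copying-complete _ , copied)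

-- Two layers

Pads : List (Maybe A × Maybe B) → List A → List B → Set
Pads w xs ys = ∃[ k ] ∃[ l ] (map proj₁ w ≡ pad k xs × map proj₂ w ≡ pad l ys)

blanks : Maybe A × Maybe B
blanks = nothing , nothing

pads-snoc : ∀ (w : List (Maybe A × Maybe B)) {k l xs ys} →
            map proj₁ w ≡ pad k xs → map proj₂ w ≡ pad l ys →
            map proj₁ (w ++ blanks ∷ []) ≡ pad (suc k) xs ×
            map proj₂ (w ++ blanks ∷ []) ≡ pad (suc l) ys
pads-snoc w {k} {l} {xs} {ys} eq eq′ =
  trans (map-++ proj₁ w _) (trans (cong (_++ _) eq) (pad-snoc k xs)) ,
  trans (map-++ proj₂ w _) (trans (cong (_++ _) eq′) (pad-snoc l ys))

pads-unsnoc : ∀ (w : List (Maybe A × Maybe B)) {xs ys} →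
              Pads (w ++ blanks ∷ []) xs ys → Pads w xs ys
pads-unsnoc w {xs} {ys} (k , l , eq , eq′)
  with j , _ , e ← pad-unsnoc (map proj₁ w) k xs (trans (≡-sym (map-++ proj₁ w _)) eq)
     | j′ , _ , e′ ← pad-unsnoc (map proj₂ w) l ys (trans (≡-sym (map-++ proj₂ w _)) eq′) =
  j , j′ , e , e′

pads-reverse-∷ : ∀ (v : List (Maybe A × Maybe B)) {xs ys} →
                 Pads (reverse (blanks ∷ v)) xs ys → Pads (reverse v) xs ys
pads-reverse-∷ v {xs} {ys} p =
  pads-unsnoc (reverse v) (subst (λ w → Pads w xs ys) (unfold-reverse blanks v) p)

-- The canonical code of two words: as long as the longer one, so that its last cell is never doubly
-- blank.
zipPad : List A → List B → List (Maybe A × Maybe B)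
zipPad []       []       = []
zipPad []       (y ∷ ys) = (nothing , just y) ∷ zipPad [] ys
zipPad (x ∷ xs) []       = (just x , nothing) ∷ zipPad xs []
zipPad (x ∷ xs) (y ∷ ys) = (just x , just y) ∷ zipPad xs ys

zipPad-pads : ∀ (xs : List A) (ys : List B) → Pads (zipPad xs ys) xs ys
zipPad-pads []       []       = 0 , 0 , refl , refl
zipPad-pads []       (y ∷ ys) with k , l , eq , eq′ ← zipPad-pads [] ys =
  suc k , l , cong (nothing ∷_) eq , cong (just y ∷_) eq′
zipPad-pads (x ∷ xs) []       with k , l , eq , eq′ ← zipPad-pads xs [] =
  k , suc l , cong (just x ∷_) eq , cong (nothing ∷_) eq′
zipPad-pads (x ∷ xs) (y ∷ ys) with k , l , eq , eq′ ← zipPad-pads xs ys =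
  k , l , cong (just x ∷_) eq , cong (just y ∷_) eq′

-- Once both words are exhausted, every remaining cell is doubly blank; so a code is canonical or
-- ends in such a cell.
pads⇒zipPad : ∀ (w : List (Maybe A × Maybe B)) xs ys → Pads w xs ys →
              w ≡ zipPad xs ys ⊎ ∃[ w₁ ] w ≡ w₁ ++ blanks ∷ []
pads⇒zipPad w xs ys (k , l , eq , eq′) = go w xs ys k l eq eq′
  where
  cons : ∀ {w z : List (Maybe A × Maybe B)} {p q} → p ≡ q →
         w ≡ z ⊎ ∃[ w₁ ] w ≡ w₁ ++ blanks ∷ [] →
         p ∷ w ≡ q ∷ z ⊎ ∃[ w₁ ] p ∷ w ≡ w₁ ++ blanks ∷ []
  cons {p = p} refl = [ inj₁ ∘ cong (p ∷_) , (λ { (w₁ , eq) → inj₂ (p ∷ w₁ , cong (p ∷_) eq) }) ]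

  go : ∀ w xs ys k l → map proj₁ w ≡ pad k xs → map proj₂ w ≡ pad l ys →
       w ≡ zipPad xs ys ⊎ ∃[ w₁ ] w ≡ w₁ ++ blanks ∷ []
  go []      []       []       _       _       _  _   = inj₁ refl
  go []      []       (_ ∷ _)  _       _       _  ()
  go []      (_ ∷ _)  _        _       _       () _
  go (p ∷ w) []       []       (suc k) (suc l) eq eq′
    with refl , e ← ∷-injective eq | refl , e′ ← ∷-injective eq′ with go w [] [] k l e e′
  ... | inj₁ refl     = inj₂ ([] , refl)
  ... | inj₂ (w₁ , e) = inj₂ (p ∷ w₁ , cong (p ∷_) e)
  go (p ∷ w) []       []       zero    _       () _
  go (p ∷ w) []       []       (suc _) zero    _  ()
  go (p ∷ w) []       (y ∷ ys) zero    l       () _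
  go (p ∷ w) []       (y ∷ ys) (suc k) l       eq eq′
    with refl , e ← ∷-injective eq | refl , e′ ← ∷-injective eq′ = cons refl (go w [] ys k l e e′)
  go (p ∷ w) (x ∷ xs) []       k       zero    _  ()
  go (p ∷ w) (x ∷ xs) []       k       (suc l) eq eq′
    with refl , e ← ∷-injective eq | refl , e′ ← ∷-injective eq′ = cons refl (go w xs [] k l e e′)
  go (p ∷ w) (x ∷ xs) (y ∷ ys) k       l       eq eq′
    with refl , e ← ∷-injective eq | refl , e′ ← ∷-injective eq′ = cons refl (go w xs ys k l e e′)

module Product {Σ Σ′ : Set} (M : LLBM Σ) (N : Normalized M) (M′ : LLBM Σ′) (N′ : Normalized M′)
               (C : Subset (Σ × Σ′)) where

  module L  = Layer M N
  module L′ = Layer M′ N′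

  K : Set
  K = L.K × L′.K

  Phase : Set
  Phase = ⟦ C ⟧ ⊎ ⟦ C ⟧ ⊎ ⊤ ⊎ ⊤ ⊎ ⊥

  pattern starting c = #0 c
  pattern reading c  = #1 c
  pattern running    = #2 tt
  pattern ending     = #3 tt

  Z : Set
  Z = Phase × L.State × L′.State

  checks : Phase → Z
  checks ph = ph , L.unopened , L′.unopened

  steps : Phase → Maybe Σ → Maybe Σ′ → Z
  steps ph x x′ = ph , L.scanning x , L′.scanning x′

  data Trans : Z → K → K → Z → Set where
    both : ∀ {ph s x y s₁ s′ x′ y′ s₁′} → L.Trans s x y s₁ → L′.Trans s′ x′ y′ s₁′ →
           Trans (ph , s , s′) (x , x′) (y , y′) (ph , s₁ , s₁′)

  data Next : Phase → Maybe Z → Set where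
    checked  : ∀ {a b t} →
               Next (starting ((a , b) , t)) (just (steps (reading ((a , b) , t)) (just a) (just b)))
    read     : ∀ {c} → Next (reading c) (just (steps running nothing nothing))
    step     : Next running (just (steps running nothing nothing))
    stop     : Next running (just (checks ending))
    finished : Next ending nothing

  data Turn : Z → Maybe Z → Set where
    turn : ∀ {ph s s′ m} → L.Accepting s → L′.Accepting s′ → Next ph m → Turn (ph , s , s′) m

  ⟦C⟧-finite : Finite ⟦ C ⟧
  ⟦C⟧-finite = finite-⟦⟧ (finite-× (LLBM.Σ-finite M) (LLBM.Σ-finite M′)) C

  phase-finite : Finite Phase
  phase-finite = finite-⊎ ⟦C⟧-finite (finite-⊎ ⟦C⟧-finite
    (finite-⊎ finite-⊤ (finite-⊎ finite-⊤ finite-⊥)))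

  nonblank : Subset K
  nonblank (just _  , _)       = true
  nonblank (nothing , just _)  = true
  nonblank (nothing , nothing) = false

  automaton : SweepingAutomaton ⟦ C ⟧ K
  automaton = record
    { Z = Z
    ; Z-finite = finite-× phase-finite (finite-× L.state-finite L′.state-finite)
    ; Trans = Trans
    ; Trans-enumerable = enumerable-image
        (λ { (ph , (_ , _ , _ , _ , t) , (_ , _ , _ , _ , t′)) →
             (ph , _) , _ , _ , _ , both t t′ })
        (λ { (_ , _ , _ , _ , both t t′) → (_ , (_ , _ , _ , _ , t) , (_ , _ , _ , _ , t′)) , refl })
        (enumerable-× (finite⇒enumerable phase-finite)
          (enumerable-× L.trans-enumerable L′.trans-enumerable))
    ; Turn = Turn
    ; Turn-enumerable = enumerable-image
        (λ { ((_ , a) , (_ , a′) , (_ , _ , n)) → _ , _ , turn a a′ n })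
        (λ { (_ , _ , turn a a′ n) → ((_ , a) , (_ , a′) , (_ , _ , n)) , refl })
        (enumerable-× L.accepting-enumerable
          (enumerable-× L′.accepting-enumerable next-enumerable))
    -- `inj₁` is the phase `starting`, which keeps the letters until the source has been checked.
    ; start = checks ∘ inj₁
    ; blank = blanks
    ; nonblank = nonblank
    }
    where
    next-enumerable : Enumerable (∃[ ph ] ∃[ m ] Next ph m)
    next-enumerable = enumerable-image
      (λ { (#0 c) → _ , _ , checked
         ; (#1 c) → _ , _ , read {c}
         ; (#2 _) → _ , _ , step
         ; (#3 _) → _ , _ , stop
         ; (#4 _) → _ , _ , finished
         })
      (λ { (_ , _ , checked {a} {b} {t}) → #0 ((a , b) , t) , refl
         ; (_ , _ , read {c}) → #1 c , refl
         ; (_ , _ , step) → #2 tt , refl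
         ; (_ , _ , stop) → #3 tt , refl
         ; (_ , _ , finished) → #4 tt , refl
         })
      (finite⇒enumerable (finite-⊎ ⟦C⟧-finite (finite-⊎ ⟦C⟧-finite
        (finite-⊎ finite-⊤ (finite-⊎ finite-⊤ (finite-⊎ finite-⊤ finite-⊥))))))

  ⟦C⟧⊆K : ⟦ C ⟧ ↣ K
  ⟦C⟧⊆K = mk↣ {to = λ { ((a , b) , _) → L.cell (sym (Γ.to a)) , L′.cell (sym (Γ′.to b)) }}
    λ { {(a , b) , _} {(a′ , b′) , _} eq → ⟦⟧-≡ (cong₂ _,_
          (Γ.injective (cell-injective (cong proj₁ eq)))
          (Γ′.injective (cell-injective (cong proj₂ eq)))) }
    where
    module Γ  = Injection (LLBM.Σ⊆Γ M)
    module Γ′ = Injection (LLBM.Σ⊆Γ M′)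
    cell-injective : {Q Γ : Set} {A B : Γ} →
                     _≡_ {A = Maybe (Q ⊎ Cell Γ)} (just (inj₂ (sym A))) (just (inj₂ (sym B))) → A ≡ B
    cell-injective refl = refl

  open SweepingAutomaton automaton
    using (Computation; again; halt; Trim; stop; drop; Trimmed; trimmed; trim-trimmed; computation-trimmed)
  open SweepingMachine ⟦C⟧-finite (finite-× L.K-finite L′.K-finite) ⟦C⟧⊆K automaton public

  -- A record, so that unification can recover the two configurations, which it could not do through
  -- `letters`.
  record Codes (w : List K) (c : L.Configuration) (c′ : L′.Configuration) : Set where
    constructor codes
    field
      pads : Pads w (L.letters c) (L′.letters c′)

  codes-functional : ∀ {w c d c′ d′} → Codes w c c′ → Codes w d d′ → c ≡ d × c′ ≡ d′
  codes-functional (codes (_ , _ , eq , eq′)) (codes (_ , _ , e , e′)) =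
    L.letters-injective (pad-injective _ _ _ _ (trans (≡-sym eq) e)) ,
    L′.letters-injective (pad-injective _ _ _ _ (trans (≡-sym eq′) e′))

  -- A trimmed tape does not end in a doubly blank cell, so it is the canonical code of the two
  -- words.
  codes-injective : ∀ {u v c c′} → Trimmed u → Trimmed v →
                    Codes (reverse u) c c′ → Codes (reverse v) c c′ → u ≡ v
  codes-injective {u} {v} tu tv (codes cu) (codes cv) =
    reverse-injective (trans (normal u tu cu) (≡-sym (normal v tv cv)))
    where
    normal : ∀ {xs ys} u → Trimmed u → Pads (reverse u) xs ys → reverse u ≡ zipPad xs ys
    normal u t p with pads⇒zipPad (reverse u) _ _ p
    ... | inj₁ eq        = eq
    ... | inj₂ (w₁ , eq)
      with refl ← trans (≡-sym (reverse-involutive u)) (trans (cong reverse eq) (reverse-++ w₁ _))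
      with trimmed () ← t

  -- Each dropped cell is doubly blank, hence padding in both layers.
  trim-pads : ∀ {v u xs ys} → Trim v u → Pads (reverse v) xs ys → Pads (reverse u) xs ys
  trim-pads (stop _) p = p
  trim-pads (drop {nothing , nothing} {v} _ t) p =
    trim-pads t (pads-reverse-∷ v p)

  -- As the first word is nonempty, a nonblank cell is met before the tape is exhausted.
  trim-exists : ∀ v {x xs ys} → Pads (reverse v) (x ∷ xs) ys → ∃[ u ] Trim v u
  trim-exists []                       (_ , _ , () , _)
  trim-exists ((just _ , _) ∷ v)       p = _ , stop tt
  trim-exists ((nothing , just _) ∷ v) p = _ , stop tt
  trim-exists ((nothing , nothing) ∷ v) {x} {xs} p
    with u , t ← trim-exists v {x} {xs} (pads-reverse-∷ v p) = u , drop tt t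

  trim-codes : ∀ {w c c′} → Codes w c c′ → ∃[ u ] (Trim (reverse w) u × Codes (reverse u) c c′)
  trim-codes {w} {c} {c′} (codes p)
    with p′ ← subst (λ w → Pads w (L.letters c) (L′.letters c′)) (≡-sym (reverse-involutive w)) p
    with _ , _ , eq ← L.letters-nonempty c
    with u , t ← trim-exists (reverse w)
           (subst (λ xs → Pads (reverse (reverse w)) xs (L′.letters c′)) eq p′) =
    u , t , codes (trim-pads t p′)

  code-exists : ∀ c c′ → ∃[ u ] (Trimmed u × Codes (reverse u) c c′)
  code-exists c c′
    with u , t , p ← trim-codes {c = c} {c′}
           (codes (zipPad-pads (L.letters c) (L′.letters c′))) =
    u , trim-trimmed t , p

  run-split : ∀ {ph s s′ w w₁ z} → Run Trans (ph , s , s′) w w₁ z → ∃[ s₁ ] ∃[ s₁′ ]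
              (z ≡ (ph , s₁ , s₁′) × Run L.Trans s (map proj₁ w) (map proj₁ w₁) s₁ ×
               Run L′.Trans s′ (map proj₂ w) (map proj₂ w₁) s₁′)
  run-split []                 = _ , _ , refl , [] , []
  run-split (both t t′ ∷ run) with _ , _ , refl , r , r′ ← run-split run =
    _ , _ , refl , t ∷ r , t′ ∷ r′

  sweep-split : ∀ {ph s s′ w w₁ z m} → Run Trans (ph , s , s′) w w₁ z → Turn z m →
                L.Sweep s (map proj₁ w) (map proj₁ w₁) ×
                L′.Sweep s′ (map proj₂ w) (map proj₂ w₁) × Next ph m
  sweep-split run t with _ , _ , refl , r , r′ ← run-split run | t
  ... | turn a a′ n = (_ , r , a) , (_ , r′ , a′) , n

  -- Runs preserve length, so the two outputs fit together into one tape.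
  run-join : ∀ {ph s s′ s₁ s₁′ y y′} w → Run L.Trans s (map proj₁ w) y s₁ →
             Run L′.Trans s′ (map proj₂ w) y′ s₁′ →
             ∃[ w₁ ] (map proj₁ w₁ ≡ y × map proj₂ w₁ ≡ y′ ×
                      Run Trans (ph , s , s′) w w₁ (ph , s₁ , s₁′))
  run-join []      []      []        = [] , refl , refl , []
  run-join (_ ∷ w) (t ∷ r) (t′ ∷ r′) with w₁ , refl , refl , run ← run-join w r r′ =
    _ ∷ w₁ , refl , refl , both t t′ ∷ run

  sweep-join : ∀ {ph m s s′ x x′ y y′ w} → Next ph m →
               map proj₁ w ≡ x → map proj₂ w ≡ x′ → L.Sweep s x y → L′.Sweep s′ x′ y′ →
               ∃[ w₁ ] ∃[ z ] (map proj₁ w₁ ≡ y × map proj₂ w₁ ≡ y′ ×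
                               Run Trans (ph , s , s′) w w₁ z × Turn z m)
  sweep-join {w = w} n refl refl (_ , r , a) (_ , r′ , a′)
    with w₁ , eq , eq′ , run ← run-join w r r′ = w₁ , _ , eq , eq′ , run , turn a a′ n

  -- Computations of the product machine and edges of the product graph

  ExternalPair : L.Configuration → L′.Configuration → Set
  ExternalPair c c′ = L.External c × L′.External c′

  check-split : ∀ {ph w w₁ z m} → Run Trans (checks ph) w w₁ z → Turn z m →
                (∃[ c ] ∃[ c′ ] (ExternalPair c c′ × Codes w c c′ × Codes w₁ c c′)) × Next ph m
  check-split run t with s , s′ , n ← sweep-split run t
    with eq , c , k , e , ext ← L.check-sound s | eq′ , c′ , l , e′ , ext′ ← L′.check-sound s′ =
    (c , c′ , (ext , ext′) , codes (k , l , e , e′) ,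
     codes (k , l , trans (≡-sym eq) e , trans (≡-sym eq′) e′)) , n

  step-split : ∀ {ph x x′ c c′ w w₁ z m} → Codes w c c′ → Run Trans (steps ph x x′) w w₁ z →
               Turn z m → (∃[ d ] ∃[ d′ ] (L.Move x c d × L′.Move x′ c′ d′ × Codes w₁ d d′)) × Next ph m
  step-split {x = x} {x′} {c} {c′} {w₁ = w₁} (codes (k , l , eq , eq′)) run t
    with s , s′ , n ← sweep-split run t
    with d , k′ , e , move ← L.step-sound {c = c} {k = k}
           (subst (λ w → L.Sweep (L.scanning x) w (map proj₁ w₁)) eq s)
       | d′ , l′ , e′ , move′ ← L′.step-sound {c = c′} {k = l}
           (subst (λ w → L′.Sweep (L′.scanning x′) w (map proj₂ w₁)) eq′ s′) =
    (d , d′ , move , move′ , codes (k′ , l′ , e , e′)) , n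

  _⟶*_ : L.Configuration → L.Configuration → Set
  _⟶*_ = Star (λ c d → Step M c nothing d)

  _⟶′*_ : L′.Configuration → L′.Configuration → Set
  _⟶′*_ = Star (λ c d → Step M′ c nothing d)

  move* : ∀ {c d e} → L.Move nothing c d → d ⟶* e → c ⟶* e
  move* (inj₁ s)          ss = s ◅ ss
  move* (inj₂ (_ , refl)) ss = ss

  move′* : ∀ {c d e} → L′.Move nothing c d → d ⟶′* e → c ⟶′* e
  move′* (inj₁ s)          ss = s ◅ ss
  move′* (inj₂ (_ , refl)) ss = ss

  ending-sound : ∀ {w u d d′} → Codes w d d′ → Computation (checks ending) w u →
                 ExternalPair d d′ × Codes (reverse u) d d′
  ending-sound p (again run t _) with _ , () ← check-split run t
  ending-sound p (halt {w₁} run t u)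
    with (_ , _ , ext , p′ , p₁) , _ ← check-split run t
    with refl , refl ← codes-functional p p′ =
    ext , codes (trim-pads u (Codes.pads (subst (λ w → Codes w _ _) (≡-sym (reverse-involutive w₁)) p₁)))

  -- Each sweep in this phase prolongs either path by at most one ε-step.
  running-sound : ∀ {w u c c′} → Codes w c c′ → Computation (steps running nothing nothing) w u →
                  ∃[ d ] ∃[ d′ ] (c ⟶* d × c′ ⟶′* d′ × ExternalPair d d′ × Codes (reverse u) d d′)
  running-sound p (halt run t _) with _ , () ← step-split p run t
  running-sound p (again run t comp) with step-split p run t
  ... | (_ , _ , move , move′ , p₁) , step
    with d , d′ , ss , ss′ , res ← running-sound p₁ comp =
    d , d′ , move* move ss , move′* move′ ss′ , res
  ... | (d , d′ , move , move′ , p₁) , stop =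
    d , d′ , move* move ε , move′* move′ ε , ending-sound p₁ comp

  G : Graph (L.Configuration × L′.Configuration) ⟦ C ⟧
  G = transitionGraph M N ⊗[ C ] transitionGraph M′ N′

  reading-sound : ∀ {a b t w u c c′} → ExternalPair c c′ → Codes w c c′ →
                  Computation (steps (reading ((a , b) , t)) (just a) (just b)) w u →
                  ∃[ d ] (G (c , c′) ((a , b) , t) d × Codes (reverse u) (proj₁ d) (proj₂ d))
  reading-sound _ p (halt run t _) with _ , () ← step-split p run t
  reading-sound (ext , ext′) p (again run t comp) with step-split p run t
  ... | (_ , _ , inj₁ s , inj₁ s′ , p₁) , read
    with d , d′ , ss , ss′ , (ext₁ , ext₁′) , pᵤ ← running-sound p₁ comp =
    (d , d′) , ((ext , ext₁ , _ , s , ss) , (ext′ , ext₁′ , _ , s′ , ss′)) , pᵤ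
  -- Idling requires the label ε, so on a letter both layers make a genuine step.
  ... | (_ , _ , inj₂ (() , _) , _) , _
  ... | (_ , _ , inj₁ _ , inj₂ (() , _) , _) , _

  starting-sound : ∀ {a w u} → Computation (checks (starting a)) w u →
                   ∃[ c ] ∃[ d ] (G c a d × Codes w (proj₁ c) (proj₂ c) ×
                                  Codes (reverse u) (proj₁ d) (proj₂ d))
  starting-sound (halt run t _) with _ , () ← check-split run t
  starting-sound (again run t comp) with check-split run t
  ... | (c , c′ , ext , p , p₁) , checked with d , g , pᵤ ← reading-sound ext p₁ comp =
    (c , c′) , d , g , p , pᵤ

  ending-complete : ∀ {w d d′} → ExternalPair d d′ → Codes w d d′ →
                    ∃[ u ] (Computation (checks ending) w u × Codes (reverse u) d d′)
  ending-complete {d = d} {d′} (ext , ext′) (codes (k , l , eq , eq′))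
    with w₁ , _ , e , e′ , run , t ← sweep-join finished eq eq′
           (L.check-complete d k ext) (L′.check-complete d′ l ext′)
    with u , w₁↝u , p ← trim-codes {w₁} {d} {d′} (codes (k , l , e , e′)) =
    u , halt run t w₁↝u , p

  -- The two paths are performed one after the other: first the steps of the first layer while the
  -- second idles, then the reverse.
  running-complete : ∀ {w c c′ d d′} → c ⟶* d → c′ ⟶′* d′ → ExternalPair d d′ → Codes w c c′ →
                     ∃[ u ] (Computation (steps running nothing nothing) w u ×
                             Codes (reverse u) d d′)
  -- The turn to `ending` is taken at the end of a running sweep, so one last sweep idles in both
  -- layers.
  running-complete {c = c} {c′} ε ε ext (codes (k , l , eq , eq′))
    with _ , _ , e , e′ , run , t ← sweep-join stop eq eq′ (L.stay-complete c k) (L′.stay-complete c′ l)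
    with u , comp , res ← ending-complete ext (codes (k , l , e , e′)) =
    u , again run t comp , res
  running-complete {c′ = c′} (s ◅ ss) ss′ ext (codes (k , l , eq , eq′))
    with k′ , sw ← L.step-complete k s
    with _ , _ , e , e′ , run , t ← sweep-join step eq eq′ sw (L′.stay-complete c′ l)
    with u , comp , res ← running-complete ss ss′ ext (codes (k′ , l , e , e′)) =
    u , again run t comp , res
  running-complete {c = c} ε (s′ ◅ ss′) ext (codes (k , l , eq , eq′))
    with l′ , sw′ ← L′.step-complete l s′
    with _ , _ , e , e′ , run , t ← sweep-join step eq eq′ (L.stay-complete c k) sw′
    with u , comp , res ← running-complete ε ss′ ext (codes (k , l′ , e , e′)) =
    u , again run t comp , res

  starting-complete : ∀ {c a d w} → G c a d → Codes w (proj₁ c) (proj₂ c) →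
                      ∃[ u ] (Computation (checks (starting a)) (w ++ blanks ∷ []) u ×
                              Codes (reverse u) (proj₁ d) (proj₂ d))
  starting-complete {c , c′} {w = w}
    ((ext , ext₁ , _ , s , ss) , (ext′ , ext₁′ , _ , s′ , ss′)) (codes (k , l , eq , eq′))
    -- The appended cell gives each layer the extra blank that its letter step may consume.
    with e , e′ ← pads-snoc w eq eq′
    with _ , _ , e₁ , e₁′ , run₁ , t₁ ← sweep-join checked e e′
           (L.check-complete c (suc k) ext) (L′.check-complete c′ (suc l) ext′)
    with k₂ , sw ← L.step-complete k s | l₂ , sw′ ← L′.step-complete l s′
    with _ , _ , e₂ , e₂′ , run₂ , t₂ ← sweep-join read e₁ e₁′ sw sw′
    with u , comp , res ← running-complete ss ss′ (ext₁ , ext₁′) (codes (k₂ , l₂ , e₂ , e₂′)) =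
    u , again run₁ t₁ (again run₂ t₂ comp) , res

  -- The correspondence between trimmed tapes and pairs of configurations

  Represents : Configuration → L.Configuration × L′.Configuration → Set
  Represents e (c , c′) = ∃[ u ] (e ≡ at-rest u × Trimmed u × Codes (reverse u) c c′)

  -- Functionality is unique decoding, injectivity is uniqueness of the trimmed code, and the edge
  -- conditions are soundness and completeness of the computations.
  correspondence : Correspondence G (transitionGraph machine normalized)
  correspondence = record
    { _~_ = Represents
    ; functional = functional
    ; injective = λ { (_ , refl , t , p) (_ , refl , t′ , p′) →
        cong at-rest (codes-injective t t′ p p′) }
    ; edge-to = edge-to
    ; edge-from = edge-from
    }
    where
    functional : ∀ {e c d} → Represents e c → Represents e d → c ≡ d
    functional (u , refl , _ , p) (v , eq , _ , p′)
      with refl ← at-rest-injective {u} {v} eq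
      with refl , refl ← codes-functional p p′ = refl

    edge-to : ∀ {e a e′} → transitionGraph machine normalized e a e′ →
              ∃[ c ] ∃[ d ] (Represents e c × Represents e′ d × G c a d)
    edge-to edge with u , u′ , refl , refl , t , comp ← edge-sound edge
      with c , d , g , p , p′ ← starting-sound comp =
      c , d ,
      -- The computation starts with the blank cell appended; removing it leaves a code of the same
      -- pair.
      (u , refl , t , codes (pads-unsnoc (reverse u)
        (Codes.pads (subst (λ w → Codes w _ _) (ʳ++-defn u) p)))) ,
      (u′ , refl , computation-trimmed comp , p′) , g

    edge-from : ∀ {c a d} → G c a d →
                ∃[ e ] ∃[ e′ ] (Represents e c × Represents e′ d ×
                                 transitionGraph machine normalized e a e′)
    edge-from {c , c′} {a} g =
      let u , t , p = code-exists c c′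
          u′ , comp , p′ = starting-complete g p in
      at-rest u , at-rest u′ , (u , refl , t , p) , (u′ , refl , computation-trimmed comp , p′) ,
      edge-complete t (subst (λ w → Computation (checks (starting a)) w u′) (≡-sym (ʳ++-defn u)) comp)

proposition9 : {V V′ Σ Σ′ : Set} →
    Countable V → Countable V′ → Finite Σ → Finite Σ′ →
    (G : Graph V Σ) (G′ : Graph V′ Σ′) (C : Subset (Σ × Σ′)) →
    LinearlyBounded G → LinearlyBounded G′ →
    LinearlyBounded (G ⊗[ C ] G′)
-- Trimmed tapes correspond to pairs of configurations, and these to pairs of vertices through the
-- given isomorphisms.
proposition9 _ _ _ _ G G′ C (M , N , G≅) (M′ , N′ , G′≅) =
  P.machine , P.normalized , correspondence⇒≅
    (correspondence-trans
      (correspondence-⊗ C (≅⇒correspondence G≅) (≅⇒correspondence G′≅)) P.correspondence)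
  where module P = Product M N M′ N′ C
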